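{- Let $H\ge1$, $V$ a finite node set and $r\in V$. Let $\mathcal{A}$ and $\mathcal{P}$ be the hop-constrained tree polytopes defined in the context, and let $\mathcal{A}_X=\{x:\exists y,\ (x,y)\in\mathcal{A}\}$ and $\mathcal{P}_X=\{x:\exists l,g,\ (x,l,g)\in\mathcal{P}\}$ be their projections onto the $x$-variable space. Then $\mathcal{P}_X\subseteq\mathcal{A}_X$.
   Context: Setting: $V$ is the node set of a complete undirected graph, $r\in V$ a root, $H$ the hop limit. For every ordered pair $(u,v)$ of distinct nodes there is a real variable $x_{u,v}$. Common constraints: (X1) $\sum_{u\in V\setminus\{v\}}x_{u,v}\le 1$ for all $v\in V$; (X2) $\sum_{u\in V\setminus\{v,w\}}x_{u,v}\ge x_{v,w}$ for all $v\in V\setminus\{r\}$, $w\in V\setminus\{v\}$; (X3) $0\le x_{u,v}\le 1$ for all arcs. Partial-ordering polytope $\mathcal{P}$: variables $x$ and $l_{v,i},g_{i,v}$ for $v\in V$, $i\in\{0,\dots,H\}$, satisfying (X1)–(X3) and: $l_{r,0}=g_{0,r}=0$; $l_{v,1}=g_{H,v}=0$ for $v\neq r$; $l_{v,i}-l_{v,i+1}\le0$ for $v\in V$, $i=0,\dots,H-1$; $g_{i,v}+l_{v,i+1}=1$ for $v\in V$, $i=0,\dots,H-1$; $l_{u,i}+g_{i,v}\ge x_{u,v}$ for $u\in V$, $v\neq u$, $i=0,\dots,H$; $0\le l_{v,i},g_{i,v}\le1$. Assignment polytope $\mathcal{A}$: variables $x$ and $y_{v,i}$ for $v\in V$, $i\in\{0,\dots,H\}$,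 satisfying (X1)–(X3) and: $y_{r,0}=1$; $y_{r,i}=0$ for $i=1,\dots,H$; $y_{v,0}=0$ for $v\neq r$; $\sum_{i=1}^H y_{v,i}=1$ for $v\neq r$; $y_{u,i}-y_{v,i+1}+x_{u,v}\le1$ for $u\in V$, $v\neq u$, $i=0,\dots,H-1$; $y_{u,H}+x_{u,v}\le 1$ for $u\in V$, $v\neq u$; $0\le y_{v,i}\le 1$. -}

module Defs where

open import Algebra.Bundles using (CommutativeRing)
open import Data.Fin.Base using (Fin; zero; suc; toℕ; fromℕ; inject₁)
open import Data.Fin.Properties using (_≟_)
open import Data.Nat.Base using (ℕ; suc)
open import Data.Product.Base using (∃; ∃₂; _×_; proj₁)
open import Level using (Level; _⊔_) renaming (suc to lsuc)
open import Relation.Binary.Core using (Rel)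
open import Relation.Binary.PropositionalEquality.Core using (_≡_; _≢_)
open import Relation.Binary.Structures using (IsDecTotalOrder)
open import Relation.Nullary.Decidable using (Dec; yes; no; ¬?; _×-dec_)
open import Relation.Nullary.Negation using (¬_)
open import Relation.Unary using (Pred; Decidable)

-- Linearly ordered fields stand in for ℝ, which the standard library does not
-- provide; ℝ (read classically, with decidable order) and ℚ are instances.
record OrderedField c ℓ₁ ℓ₂ : Set (lsuc (c ⊔ ℓ₁ ⊔ ℓ₂)) where
  infix 4 _≤_
  field
    commutativeRing : CommutativeRing c ℓ₁
  open CommutativeRing commutativeRing public
  field
    _≤_             : Rel Carrier ℓ₂
    isDecTotalOrder : IsDecTotalOrder _≈_ _≤_
    +-monoˡ-≤       : ∀ z {x y} → x ≤ y → x + z ≤ y + z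
    *-nonneg        : ∀ {x y} → 0# ≤ x → 0# ≤ y → 0# ≤ x * y
    0≉1             : ¬ 0# ≈ 1#
    inverse         : ∀ x → ¬ x ≈ 0# → ∃ λ y → x * y ≈ 1#

module Polytopes {c ℓ₁ ℓ₂} (F : OrderedField c ℓ₁ ℓ₂)
                 (n : ℕ) (r : Fin n) (H : ℕ) where

  open OrderedField F hiding (zero)
  open import Algebra.Properties.CommutativeMonoid.Sum +-commutativeMonoid
    using (sum)

  V : Set
  V = Fin n

  -- The index set {0, …, H}.  For i : Fin H, the indices i and i + 1 are
  -- inject₁ i and suc i; the index H is fromℕ H.
  Index : Set
  Index = Fin (suc H)

  -- There is no variable x u u.  The proof of u ≢ v is irrelevant, so each
  -- ordered pair of distinct nodes carries exactly one value.
  ArcVector : Set c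
  ArcVector = (u v : V) → .(u ≢ v) → Carrier

  ∑-over : ∀ {p} {P : Pred V p} → Decidable P →
           ((u : V) → .(P u) → Carrier) → Carrier
  ∑-over {P = P} P? f = sum (λ u → term u (P? u))
    where
    term : ∀ u → Dec (P u) → Carrier
    term u (yes p) = f u p
    term u (no  _) = 0#

  inflow : ArcVector → V → Carrier
  inflow x v = ∑-over (λ u → ¬? (u ≟ v)) (λ u u≢v → x u v u≢v)

  inflowAvoiding : ArcVector → V → V → Carrier
  inflowAvoiding x v w =
    ∑-over (λ u → ¬? (u ≟ v) ×-dec ¬? (u ≟ w)) (λ u u≢v,w → x u v (proj₁ u≢v,w))

  InUnitInterval : Pred Carrier ℓ₂
  InUnitInterval a = 0# ≤ a × a ≤ 1#

  record Common (x : ArcVector) : Set ℓ₂ where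
    field
      X1 : ∀ v → inflow x v ≤ 1#
      X2 : ∀ v → v ≢ r → ∀ w → (v≢w : v ≢ w) → x v w v≢w ≤ inflowAvoiding x v w
      X3 : ∀ u v → (u≢v : u ≢ v) → InUnitInterval (x u v u≢v)

  record 𝒫 (x : ArcVector) (l : V → Index → Carrier) (g : Index → V → Carrier)
           : Set (ℓ₁ ⊔ ℓ₂) where
    field
      common   : Common x
      l-root   : l r zero ≈ 0#
      g-root   : g zero r ≈ 0#
      l-first  : ∀ v → v ≢ r → ∀ i → toℕ i ≡ 1 → l v i ≈ 0#
      g-last   : ∀ v → v ≢ r → g (fromℕ H) v ≈ 0#
      l-mono   : ∀ v (i : Fin H) → l v (inject₁ i) - l v (suc i) ≤ 0#
      g+l      : ∀ v (i : Fin H) → g (inject₁ i) v + l v (suc i) ≈ 1#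
      arc      : ∀ u v → (u≢v : u ≢ v) → ∀ i → x u v u≢v ≤ l u i + g i v
      l-bounds : ∀ v i → InUnitInterval (l v i)
      g-bounds : ∀ v i → InUnitInterval (g i v)

  record 𝒜 (x : ArcVector) (y : V → Index → Carrier) : Set (ℓ₁ ⊔ ℓ₂) where
    field
      common     : Common x
      root-zero  : y r zero ≈ 1#
      root-suc   : ∀ (i : Fin H) → y r (suc i) ≈ 0#
      other-zero : ∀ v → v ≢ r → y v zero ≈ 0#
      other-sum  : ∀ v → v ≢ r → sum (λ (i : Fin H) → y v (suc i)) ≈ 1#
      arc        : ∀ u v → (u≢v : u ≢ v) → ∀ (i : Fin H) →
                   (y u (inject₁ i) - y v (suc i)) + x u v u≢v ≤ 1#
      arc-last   : ∀ u v → (u≢v : u ≢ v) → y u (fromℕ H) + x u v u≢v ≤ 1#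
      y-bounds   : ∀ v i → InUnitInterval (y v i)

  𝒫X : Pred ArcVector (c ⊔ ℓ₁ ⊔ ℓ₂)
  𝒫X x = ∃₂ λ l g → 𝒫 x l g

  𝒜X : Pred ArcVector (c ⊔ ℓ₁ ⊔ ℓ₂)
  𝒜X x = ∃ λ y → 𝒜 x y

{-# OPTIONS --safe #-}

-- From (x, l, g) ∈ 𝒫 only the caps W v i = 1 − l v i are kept.  They satisfy
-- W v (i + 1) ≥ W u i + x u v − 1 and W v H ≤ 1 − x v w, so it suffices to find
-- probability vectors y v ≤ W v on the positions 1, …, H with
-- y v (i + 1) ≥ y u i + x u v − 1 and y v 1 ≥ x r v.  (The vectors
-- y = 1 − (l + g) need not satisfy the former inequality.)  The map
--   y ↦ y′,  y′ v (i + 1) = min (W v (i + 1)) (∑ u, x u v · y u i),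
-- with the remaining mass of y′ v placed at 1, preserves the polytope K of
-- all such y ≤ W, and y′ v (i + 1) ≥ y u i + x u v − 1.  The latter is a convex
-- relation between y and y′, hence holds for some pair with y = y′ by
-- Kakutani's theorem.  For a polytope K this special case of the theorem holds
-- over every ordered field: K is the hull of finitely many points, each of which
-- is related to a convex combination of them, and a stationary distribution of
-- the resulting Markov chain is a fixed point.  Everything is homogenised, so
-- that polytopes become finitely generated cones.

module Submission where

open import Defs
open import Algebra.Bundles using (RawRing)
import Algebra.Construct.NaturalChoice.Min as Min
open import Data.Fin.Base using (Fin; zero; suc; fromℕ; inject₁; punchIn; combine; remQuot)
open import Data.Fin.Properties using (_≟_; punchInᵢ≢i; remQuot-combine)
open import Data.List.Base using (List; []; _∷_; _++_; map; filter; cartesianProductWith)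
open import Data.List.Membership.Propositional using (_∈_)
open import Data.List.Membership.Propositional.Properties
  using (∈-filter⁺; ∈-filter⁻; ∈-++⁺ˡ; ∈-++⁺ʳ; ∈-map⁺; ∈-cartesianProductWith⁺)
open import Data.List.Relation.Unary.All as All using (All; []; _∷_)
import Data.List.Relation.Unary.All.Properties as Allₚ
open import Data.List.Relation.Unary.Any using (here; there)
open import Data.Maybe.Base using (Maybe; just; nothing)
open import Data.Nat.Base as ℕ using (ℕ; zero; suc)
import Data.Nat.Properties as ℕₚ
open import Data.Product.Base using (∃; ∃₂; _×_; _,_; proj₁; proj₂; uncurry)
open import Data.Product.Properties using (≡-dec)
open import Data.Sum.Base using (inj₁; inj₂; [_,_]′)
open import Function.Base using (_∘_; id)
open import Level using (_⊔_)
open import Relation.Binary.Bundles using (TotalOrder)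
open import Relation.Binary.PropositionalEquality as ≡ using (_≡_; _≢_)
open import Relation.Binary.Structures using (IsDecTotalOrder)
open import Relation.Nullary.Decidable using (Dec; yes; no; ¬?)
open import Relation.Nullary.Negation using (¬_; contradiction)
open import Relation.Unary using (Pred; Decidable; _⊆_)

-- Arithmetic, order and finite sums in an ordered field.

module OrderedFieldProperties {c ℓ₁ ℓ₂} (F : OrderedField c ℓ₁ ℓ₂) where

  open OrderedField F hiding (zero)
  open import Relation.Binary.Reasoning.Setoid setoid

  module ≤ = IsDecTotalOrder isDecTotalOrder

  -- A ring solver with integer coefficients.

  module Solver where

    open import Algebra.Solver.Ring.AlmostCommutativeRing
      using (fromCommutativeRing; _-Raw-AlmostCommutative⟶_; Induced-equivalence)
    open import Algebra.Properties.Ring ring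
    open import Algebra.Properties.CommutativeSemigroup +-commutativeSemigroup
      using (interchange)
    open import Algebra.Properties.Semiring.Mult.TCOptimised semiring
      using (×-homo-+; ×1-homo-*) renaming (_×_ to _×′_)

    cancel : ℕ × ℕ → ℕ × ℕ
    cancel (suc a , suc b) = cancel (a , b)
    cancel p               = p

    -- The pair (a , b) stands for the integer a − b.  The solver compares
    -- coefficients syntactically, hence the reduction to a canonical pair.
    integers : RawRing _ _
    integers = record
      { Carrier = ℕ × ℕ
      ; _≈_     = _≡_
      ; _+_     = λ (a , b) (c , d) → cancel (a ℕ.+ c , b ℕ.+ d)
      ; _*_     = λ (a , b) (c , d) → cancel (a ℕ.* c ℕ.+ b ℕ.* d , a ℕ.* d ℕ.+ b ℕ.* c)
      ; -_      = λ (a , b) → b , a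
      ; 0#      = 0 , 0
      ; 1#      = 1 , 0
      }

    ι : ℕ → Carrier
    ι n = n ×′ 1#

    +-ι : ∀ m n → ι (m ℕ.+ n) ≈ ι m + ι n
    +-ι = ×-homo-+ 1#

    +-*-ι : ∀ a b c d → ι (a ℕ.* b ℕ.+ c ℕ.* d) ≈ ι a * ι b + ι c * ι d
    +-*-ι a b c d = trans (+-ι (a ℕ.* b) _) (+-cong (×1-homo-* a b) (×1-homo-* c d))

    difference-+ : ∀ a b c d → (a + c) - (b + d) ≈ (a - b) + (c - d)
    difference-+ a b c d =
      trans (+-congˡ (sym (-‿+-comm b d))) (interchange a c (- b) (- d))

    difference-* : ∀ a b c d → (a * c + b * d) - (a * d + b * c) ≈ (a - b) * (c - d)
    difference-* a b c d = begin
      (a * c + b * d) - (a * d + b * c)      ≈⟨ difference-+ (a * c) (a * d) (b * d) (b * c) ⟩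
      (a * c - a * d) + (b * d - b * c)      ≈⟨ +-cong (sym (x[y-z]≈xy-xz a c d)) (sym (x[y-z]≈xy-xz b d c)) ⟩
      a * (c - d) + b * (d - c)              ≈⟨ +-congˡ (*-congˡ (sym (⁻¹-anti-homo‿- c d))) ⟩
      a * (c - d) + b * - (c - d)            ≈⟨ +-congˡ (sym (-‿distribʳ-* b (c - d))) ⟩
      a * (c - d) - b * (c - d)              ≈⟨ sym ([y-z]x≈yx-zx (c - d) a b) ⟩
      (a - b) * (c - d)                      ∎

    -- The first clause makes (0 , 0) and (1 , 0) evaluate to 0# and 1# on the nose.
    ⟦_⟧ : ℕ × ℕ → Carrier
    ⟦ a , zero    ⟧ = ι a
    ⟦ a , b@(suc _) ⟧ = ι a - ι b

    ⟦⟧≈difference : ∀ p → ⟦ p ⟧ ≈ ι (proj₁ p) - ι (proj₂ p)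
    ⟦⟧≈difference (a , zero)  = sym (trans (+-congˡ -0#≈0#) (+-identityʳ (ι a)))
    ⟦⟧≈difference (a , suc b) = refl

    ⟦cancel⟧≈difference : ∀ p → ⟦ cancel p ⟧ ≈ ι (proj₁ p) - ι (proj₂ p)
    ⟦cancel⟧≈difference (zero  , b)     = ⟦⟧≈difference (zero , b)
    ⟦cancel⟧≈difference (suc a , zero)  = ⟦⟧≈difference (suc a , zero)
    ⟦cancel⟧≈difference (suc a , suc b) = begin
      ⟦ cancel (a , b) ⟧             ≈⟨ ⟦cancel⟧≈difference (a , b) ⟩
      ι a - ι b                      ≈⟨ sym (+-identityˡ _) ⟩
      0# + (ι a - ι b)               ≈⟨ +-congʳ (sym (-‿inverseʳ (ι 1))) ⟩
      (ι 1 - ι 1) + (ι a - ι b)      ≈⟨ sym (difference-+ (ι 1) (ι 1) (ι a) (ι b)) ⟩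
      (ι 1 + ι a) - (ι 1 + ι b)      ≈⟨ sym (+-cong (+-ι 1 a) (-‿cong (+-ι 1 b))) ⟩
      ι (suc a) - ι (suc b)          ∎

    homomorphism : integers -Raw-AlmostCommutative⟶ fromCommutativeRing commutativeRing
    homomorphism = record
      { ⟦_⟧    = ⟦_⟧
      ; +-homo = λ p@(a , b) q@(c , d) → begin
          ⟦ cancel (a ℕ.+ c , b ℕ.+ d) ⟧  ≈⟨ ⟦cancel⟧≈difference (a ℕ.+ c , b ℕ.+ d) ⟩
          ι (a ℕ.+ c) - ι (b ℕ.+ d)      ≈⟨ +-cong (+-ι a c) (-‿cong (+-ι b d)) ⟩
          (ι a + ι c) - (ι b + ι d)      ≈⟨ difference-+ _ _ _ _ ⟩
          (ι a - ι b) + (ι c - ι d)      ≈⟨ sym (+-cong (⟦⟧≈difference p) (⟦⟧≈difference q)) ⟩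
          ⟦ p ⟧ + ⟦ q ⟧                  ∎
      ; *-homo = λ p@(a , b) q@(c , d) → begin
          ⟦ cancel (a ℕ.* c ℕ.+ b ℕ.* d , a ℕ.* d ℕ.+ b ℕ.* c) ⟧
            ≈⟨ ⟦cancel⟧≈difference (a ℕ.* c ℕ.+ b ℕ.* d , a ℕ.* d ℕ.+ b ℕ.* c) ⟩
          ι (a ℕ.* c ℕ.+ b ℕ.* d) - ι (a ℕ.* d ℕ.+ b ℕ.* c)
            ≈⟨ +-cong (+-*-ι a c b d) (-‿cong (+-*-ι a d b c)) ⟩
          (ι a * ι c + ι b * ι d) - (ι a * ι d + ι b * ι c)
            ≈⟨ difference-* _ _ _ _ ⟩
          (ι a - ι b) * (ι c - ι d)
            ≈⟨ sym (*-cong (⟦⟧≈difference p) (⟦⟧≈difference q)) ⟩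
          ⟦ p ⟧ * ⟦ q ⟧
            ∎
      ; -‿homo = λ p@(a , b) → begin
          ⟦ b , a ⟧        ≈⟨ ⟦⟧≈difference (b , a) ⟩
          ι b - ι a        ≈⟨ sym (⁻¹-anti-homo‿- (ι a) (ι b)) ⟩
          - (ι a - ι b)    ≈⟨ -‿cong (sym (⟦⟧≈difference p)) ⟩
          - ⟦ p ⟧          ∎
      ; 0-homo = refl
      ; 1-homo = refl
      }

    equal? : ∀ p q → Maybe (Induced-equivalence homomorphism p q)
    equal? p q with ≡-dec ℕₚ._≟_ ℕₚ._≟_ p q
    ... | yes ≡.refl = just refl
    ... | no  _      = nothing

    open import Algebra.Solver.Ring integers (fromCommutativeRing commutativeRing)
      homomorphism equal? public
      using (Polynomial; solve; _:=_; _:+_; _:*_; _:-_; :-_; con)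

    :0 :1 : ∀ {n} → Polynomial n
    :0 = con (0 , 0)
    :1 = con (1 , 0)

  open Solver public using (solve; _:=_; _:+_; _:*_; _:-_; :-_; :0; :1)

  0≤y-x : ∀ {x y} → x ≤ y → 0# ≤ y - x
  0≤y-x {x} x≤y = ≤.≤-respˡ-≈ (-‿inverseʳ x) (+-monoˡ-≤ (- x) x≤y)

  -- Linear inequalities are proved by exhibiting y − x as a nonnegative e.
  ≤-by : ∀ {x y e} → 0# ≤ e → e ≈ y - x → x ≤ y
  ≤-by {x} {y} 0≤e e≈y-x =
    ≤.≤-respˡ-≈ (+-identityˡ x) (≤.≤-respʳ-≈
      (solve 2 (λ x y → (y :- x) :+ x := y) refl x y)
      (+-monoˡ-≤ x (≤.≤-respʳ-≈ e≈y-x 0≤e)))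

  +-mono-≤ : ∀ {x y u v} → x ≤ y → u ≤ v → x + u ≤ y + v
  +-mono-≤ {x} {y} {u} {v} x≤y u≤v = ≤.trans (+-monoˡ-≤ u x≤y)
    (≤.≤-respˡ-≈ (+-comm u y) (≤.≤-respʳ-≈ (+-comm v y) (+-monoˡ-≤ y u≤v)))

  +-nonneg : ∀ {x y} → 0# ≤ x → 0# ≤ y → 0# ≤ x + y
  +-nonneg 0≤x 0≤y = ≤.≤-respˡ-≈ (+-identityʳ 0#) (+-mono-≤ 0≤x 0≤y)

  *-monoˡ-≤ : ∀ {s x y} → 0# ≤ s → x ≤ y → s * x ≤ s * y
  *-monoˡ-≤ {s} {x} {y} 0≤s x≤y = ≤-by (*-nonneg 0≤s (0≤y-x x≤y))
    (solve 3 (λ s x y → s :* (y :- x) := s :* y :- s :* x) refl s x y)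

  -- If 1 ≤ 0, then 0 - 1 is nonnegative, and so is its square, which is 1.
  0≤1 : 0# ≤ 1#
  0≤1 = [ id
        , (λ 1≤0 → ≤-by (*-nonneg (0≤y-x 1≤0) (0≤y-x 1≤0))
                     (solve 0 ((:0 :- :1) :* (:0 :- :1) := :1 :- :0) refl))
        ]′ (≤.total 0# 1#)

  1≰0 : ¬ 1# ≤ 0#
  1≰0 1≤0 = 0≉1 (≤.antisym 0≤1 1≤0)

  -- Strict positivity as a negation: it is decided by `≤.≤?`, and where it fails a nonnegative
  -- scalar is zero by antisymmetry.
  Positive : Carrier → Set ℓ₂
  Positive x = ¬ x ≤ 0#

  positive⇒nonneg : ∀ {x} → Positive x → 0# ≤ x
  positive⇒nonneg {x} x≰0 = [ id , (λ x≤0 → contradiction x≤0 x≰0) ]′ (≤.total 0# x)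

  positive-inverse : ∀ {x} → Positive x → ∃ λ y → 0# ≤ y × x * y ≈ 1#
  positive-inverse {x} x>0 with inverse x (λ x≈0 → x>0 (≤.reflexive x≈0))
  ... | y , xy≈1 = y , [ id , (λ y≤0 → contradiction (1≤0 y≤0) 1≰0) ]′ (≤.total 0# y) , xy≈1
    where
    1≤0 : y ≤ 0# → 1# ≤ 0#
    1≤0 y≤0 = ≤-by (*-nonneg (positive⇒nonneg x>0) (0≤y-x y≤0))
      (trans (solve 2 (λ x y → x :* (:0 :- y) := :0 :- x :* y) refl x y)
             (+-congˡ (-‿cong xy≈1)))

  positive-* : ∀ {x y} → Positive x → Positive y → Positive (x * y)
  positive-* {x} {y} x>0 y>0 xy≤0 with positive-inverse x>0
  ... | z , 0≤z , xz≈1 = y>0 (≤-by (*-nonneg 0≤z (0≤y-x xy≤0))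
    (trans (solve 3 (λ x y z → z :* (:0 :- x :* y) := :0 :- x :* z :* y) refl x y z)
           (+-congˡ (-‿cong (trans (*-congʳ xz≈1) (*-identityˡ y))))))

  open import Algebra.Properties.Semiring.Sum semiring public
    using (sum; sum-cong-≋; sum-remove; sum-init-last; sum-replicate-zero; ∑-distrib-+; ∑-comm; *-distribˡ-sum; *-distribʳ-sum)

  sum-mono-≤ : ∀ {n} {f g : Fin n → Carrier} → (∀ i → f i ≤ g i) → sum f ≤ sum g
  sum-mono-≤ {zero}  f≤g = ≤.refl
  sum-mono-≤ {suc n} f≤g = +-mono-≤ (f≤g zero) (sum-mono-≤ (λ i → f≤g (suc i)))

  sum-nonneg : ∀ {n} {f : Fin n → Carrier} → (∀ i → 0# ≤ f i) → 0# ≤ sum f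
  sum-nonneg {n} 0≤f = ≤.≤-respˡ-≈ (sum-replicate-zero n) (sum-mono-≤ 0≤f)

  term≤sum : ∀ {n} {f : Fin n → Carrier} → (∀ i → 0# ≤ f i) → ∀ i → f i ≤ sum f
  term≤sum {suc n} {f} 0≤f i = ≤-by (sum-nonneg (λ j → 0≤f (punchIn i j)))
    (trans (solve 2 (λ x s → s := (x :+ s) :- x) refl (f i) _)
           (+-congʳ (sym (sum-remove {i = i} f))))


  -- A point mass at `r`; it lets the weight of the root arc enter a sum over all tails in
  -- `inflow-bound`.
  indicator : ∀ {n} → Fin n → Carrier → Fin n → Carrier
  indicator r a u with u ≟ r
  ... | yes _ = a
  ... | no  _ = 0#

  sum-indicator : ∀ {n} (r : Fin n) a → sum (indicator r a) ≈ a
  sum-indicator {suc n} r a = begin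
    sum (indicator r a)                                        ≈⟨ sum-remove {i = r} (indicator r a) ⟩
    indicator r a r + sum (λ j → indicator r a (punchIn r j))  ≈⟨ +-cong at (sum-cong-≋ (λ j → off (punchInᵢ≢i r j))) ⟩
    a + sum {n} (λ _ → 0#)                                     ≈⟨ +-congˡ (sum-replicate-zero n) ⟩
    a + 0#                                                     ≈⟨ +-identityʳ a ⟩
    a                                                          ∎
    where
    at : indicator r a r ≈ a
    at with r ≟ r
    ... | yes _  = refl
    ... | no r≢r = contradiction ≡.refl r≢r

    off : ∀ {u} → u ≢ r → indicator r a u ≈ 0#
    off {u} u≢r with u ≟ r
    ... | yes u≡r = contradiction u≡r u≢r
    ... | no _    = refl

-- Finitely generated convex cones.

module Cones {c ℓ₁ ℓ₂} (F : OrderedField c ℓ₁ ℓ₂) (I : Set) where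

  open OrderedField F hiding (zero)
  open OrderedFieldProperties F
  open import Relation.Binary.Reasoning.Setoid setoid

  Point : Set c
  Point = I → Carrier

  infix  4 _≐_
  infixl 6 _⊕_
  infixr 7 _⊙_

  _≐_ : Point → Point → Set ℓ₁
  y ≐ z = ∀ j → y j ≈ z j

  𝟘 : Point
  𝟘 _ = 0#

  _⊕_ : Point → Point → Point
  (y ⊕ z) j = y j + z j

  _⊙_ : Carrier → Point → Point
  (s ⊙ y) j = s * y j

  record ConvexCone {ℓ} (S : Point → Set ℓ) : Set (c ⊔ ℓ₁ ⊔ ℓ₂ ⊔ ℓ) where
    field
      resp : ∀ {y z} → y ≐ z → S y → S z
      𝟘∈   : S 𝟘
      ⊕-closed : ∀ {y z} → S y → S z → S (y ⊕ z)
      ⊙-closed : ∀ {s y} → 0# ≤ s → S y → S (s ⊙ y)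

  ∩-convexCone : ∀ {a b} {S : Point → Set a} {T : Point → Set b} →
                 ConvexCone S → ConvexCone T → ConvexCone (λ y → S y × T y)
  ∩-convexCone S T = record
    { resp     = λ e (p , q) → S.resp e p , T.resp e q
    ; 𝟘∈       = S.𝟘∈ , T.𝟘∈
    ; ⊕-closed = λ (p , q) (p′ , q′) → S.⊕-closed p p′ , T.⊕-closed q q′
    ; ⊙-closed = λ 0≤s (p , q) → S.⊙-closed 0≤s p , T.⊙-closed 0≤s q
    }
    where
    module S = ConvexCone S
    module T = ConvexCone T

  -- Points are functions compared only pointwise, so each constructor carries a `≐` instead of
  -- fixing the point itself.
  data Cone : List Point → Point → Set (c ⊔ ℓ₁ ⊔ ℓ₂) where
    []  : ∀ {y} → y ≐ 𝟘 → Cone [] y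
    cons : ∀ {g G y s z} → 0# ≤ s → Cone G z → y ≐ s ⊙ g ⊕ z → Cone (g ∷ G) y

  -- Induction principle: a property closed under conic combinations need only be checked on
  -- generators. Taking another cone, a half-space or a preimage for `S` yields most of the
  -- inclusions below.
  cone-least : ∀ {ℓ} {S : Point → Set ℓ} → ConvexCone S →
               ∀ {G} → All S G → ∀ {y} → Cone G y → S y
  cone-least S []       ([] y≐𝟘)           = ConvexCone.resp S (sym ∘ y≐𝟘) (ConvexCone.𝟘∈ S)
  cone-least S (p ∷ ps) (cons 0≤s z∈ y≐) =
    resp (sym ∘ y≐) (⊕-closed (⊙-closed 0≤s p) (cone-least S ps z∈))
    where open ConvexCone S

  cone-convexCone : ∀ G → ConvexCone (Cone G)
  cone-convexCone [] = record
    { resp     = λ { e ([] y≐𝟘) → [] (λ j → trans (sym (e j)) (y≐𝟘 j)) }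
    ; 𝟘∈       = [] (λ _ → refl)
    ; ⊕-closed = λ { ([] y≐𝟘) ([] z≐𝟘) → [] (λ j → trans (+-cong (y≐𝟘 j) (z≐𝟘 j)) (+-identityʳ 0#)) }
    ; ⊙-closed = λ { {s} _ ([] y≐𝟘) → [] (λ j → trans (*-congˡ (y≐𝟘 j)) (zeroʳ s)) }
    }
  cone-convexCone (g ∷ G) = record
    { resp     = λ { e (cons 0≤s z∈ y≐) → cons 0≤s z∈ (λ j → trans (sym (e j)) (y≐ j)) }
    ; 𝟘∈       = cons ≤.refl 𝟘∈ (λ j → solve 1 (λ a → :0 := :0 :* a :+ :0) refl (g j))
    ; ⊕-closed = λ { (cons {s = s} {z} 0≤s z∈ y≐) (cons {s = s′} {z′} 0≤s′ z′∈ y′≐) →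
        cons (+-nonneg 0≤s 0≤s′) (⊕-closed z∈ z′∈) (λ j → trans (+-cong (y≐ j) (y′≐ j))
          (solve 5 (λ s s′ a z z′ → (s :* a :+ z) :+ (s′ :* a :+ z′) := (s :+ s′) :* a :+ (z :+ z′))
             refl s s′ (g j) (z j) (z′ j))) }
    ; ⊙-closed = λ { {t} 0≤t (cons {s = s} {z} 0≤s z∈ y≐) →
        cons (*-nonneg 0≤t 0≤s) (⊙-closed 0≤t z∈) (λ j → trans (*-congˡ (y≐ j))
          (solve 4 (λ t s a z → t :* (s :* a :+ z) := t :* s :* a :+ t :* z)
             refl t s (g j) (z j))) }
    }
    where open ConvexCone (cone-convexCone G)

  generator∈cone : ∀ {g G} → g ∈ G → Cone G g
  generator∈cone {g} {_ ∷ G} (here ≡.refl) = cons 0≤1 (ConvexCone.𝟘∈ (cone-convexCone G))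
    (λ j → solve 1 (λ a → a := :1 :* a :+ :0) refl (g j))
  generator∈cone {g} {h ∷ G} (there g∈G) = cons ≤.refl (generator∈cone g∈G)
    (λ j → solve 2 (λ a b → a := :0 :* b :+ a) refl (g j) (h j))

  -- Linear forms and half-spaces.

  record LinearForm : Set (c ⊔ ℓ₁) where
    field
      ⟦_⟧    : Point → Carrier
      ⟦⟧-cong : ∀ {y z} → y ≐ z → ⟦ y ⟧ ≈ ⟦ z ⟧
      ⟦⟧-⊕   : ∀ y z → ⟦ y ⊕ z ⟧ ≈ ⟦ y ⟧ + ⟦ z ⟧
      ⟦⟧-⊙   : ∀ s y → ⟦ s ⊙ y ⟧ ≈ s * ⟦ y ⟧

    ⟦⟧-𝟘 : ⟦ 𝟘 ⟧ ≈ 0#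
    ⟦⟧-𝟘 = trans (⟦⟧-cong (λ _ → sym (zeroˡ 0#))) (trans (⟦⟧-⊙ 0# 𝟘) (zeroˡ _))

  open LinearForm using (⟦_⟧; ⟦⟧-cong; ⟦⟧-⊕; ⟦⟧-⊙; ⟦⟧-𝟘)

  coordinate : I → LinearForm
  coordinate j = record
    { ⟦_⟧ = λ y → y j ; ⟦⟧-cong = λ e → e j ; ⟦⟧-⊕ = λ _ _ → refl ; ⟦⟧-⊙ = λ _ _ → refl }

  multiple : Carrier → LinearForm → LinearForm
  multiple a f = record
    { ⟦_⟧    = λ y → a * ⟦ f ⟧ y
    ; ⟦⟧-cong = λ e → *-congˡ (⟦⟧-cong f e)
    ; ⟦⟧-⊕   = λ y z → trans (*-congˡ (⟦⟧-⊕ f y z)) (distribˡ a _ _)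
    ; ⟦⟧-⊙   = λ s y → trans (*-congˡ (⟦⟧-⊙ f s y))
        (solve 3 (λ a s b → a :* (s :* b) := s :* (a :* b)) refl a s (⟦ f ⟧ y))
    }

  infixl 6 _⊖_
  _⊖_ : LinearForm → LinearForm → LinearForm
  f ⊖ g = record
    { ⟦_⟧    = λ y → ⟦ f ⟧ y - ⟦ g ⟧ y
    ; ⟦⟧-cong = λ e → +-cong (⟦⟧-cong f e) (-‿cong (⟦⟧-cong g e))
    ; ⟦⟧-⊕   = λ y z → trans (+-cong (⟦⟧-⊕ f y z) (-‿cong (⟦⟧-⊕ g y z)))
        (solve 4 (λ a b c d → (a :+ b) :- (c :+ d) := (a :- c) :+ (b :- d)) refl
          (⟦ f ⟧ y) (⟦ f ⟧ z) (⟦ g ⟧ y) (⟦ g ⟧ z))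
    ; ⟦⟧-⊙   = λ s y → trans (+-cong (⟦⟧-⊙ f s y) (-‿cong (⟦⟧-⊙ g s y)))
        (solve 3 (λ s a b → s :* a :- s :* b := s :* (a :- b)) refl s (⟦ f ⟧ y) (⟦ g ⟧ y))
    }

  ∑ᶠ : ∀ {k} → (Fin k → LinearForm) → LinearForm
  ∑ᶠ f = record
    { ⟦_⟧    = λ y → sum (λ i → ⟦ f i ⟧ y)
    ; ⟦⟧-cong = λ e → sum-cong-≋ (λ i → ⟦⟧-cong (f i) e)
    ; ⟦⟧-⊕   = λ y z → trans (sum-cong-≋ (λ i → ⟦⟧-⊕ (f i) y z)) (∑-distrib-+ (λ i → ⟦ f i ⟧ y) (λ i → ⟦ f i ⟧ z))
    ; ⟦⟧-⊙   = λ s y → trans (sum-cong-≋ (λ i → ⟦⟧-⊙ (f i) s y)) (sym (*-distribˡ-sum s (λ i → ⟦ f i ⟧ y)))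
    }

  halfspace-convexCone : ∀ f → ConvexCone (λ y → 0# ≤ ⟦ f ⟧ y)
  halfspace-convexCone f = record
    { resp     = λ e → ≤.≤-respʳ-≈ (⟦⟧-cong f e)
    ; 𝟘∈       = ≤.reflexive (sym (⟦⟧-𝟘 f))
    ; ⊕-closed = λ p q → ≤.≤-respʳ-≈ (sym (⟦⟧-⊕ f _ _)) (+-nonneg p q)
    ; ⊙-closed = λ 0≤s p → ≤.≤-respʳ-≈ (sym (⟦⟧-⊙ f _ _)) (*-nonneg 0≤s p)
    }

  ⟦⟧-⊙⊕ : ∀ f s y z → ⟦ f ⟧ (s ⊙ y ⊕ z) ≈ s * ⟦ f ⟧ y + ⟦ f ⟧ z
  ⟦⟧-⊙⊕ f s y z = trans (⟦⟧-⊕ f _ _) (+-congʳ (⟦⟧-⊙ f s y))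

  -- When `S` is a convex cone, the inclusion of the generated cone in `S` follows from `All S G` by
  -- `cone-least`.
  FinitelyGenerated : (Point → Set ℓ₂) → Set (c ⊔ ℓ₁ ⊔ ℓ₂)
  FinitelyGenerated S = ∃ λ G → All S G × (∀ {y} → S y → Cone G y)

  -- Double description: cutting a finitely generated cone by a half-space.

  module HalfspaceIntersection (f : LinearForm) (G : List Point) where

    nonneg? : ∀ g → Dec (0# ≤ ⟦ f ⟧ g)
    nonneg? g = 0# ≤.≤? ⟦ f ⟧ g

    G⁺ G⁻ : List Point
    G⁺ = filter nonneg? G
    G⁻ = filter (¬? ∘ nonneg?) G

    -- The point of the segment (up to scale) from n to p at which f vanishes.
    crossing : Point → Point → Point
    crossing n p j = ⟦ f ⟧ p * n j - ⟦ f ⟧ n * p j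

    generators : List Point
    generators = G⁺ ++ cartesianProductWith crossing G⁻ G⁺

    module G = ConvexCone (cone-convexCone generators)

    -- The points that decompose in this way form a convex cone, and it contains each generator,
    -- with `𝟘` as the other summand.
    split : ∀ {y} → Cone G y → ∃₂ λ p q → Cone G⁺ p × Cone G⁻ q × y ≐ p ⊕ q
    split = cone-least convexCone (All.tabulate generator)
      where
      module P = ConvexCone (cone-convexCone G⁺)
      module N = ConvexCone (cone-convexCone G⁻)

      convexCone : ConvexCone (λ y → ∃₂ λ p q → Cone G⁺ p × Cone G⁻ q × y ≐ p ⊕ q)
      convexCone = record
        { resp     = λ e (p , q , p∈ , q∈ , y≐) → p , q , p∈ , q∈ , λ j → trans (sym (e j)) (y≐ j)
        ; 𝟘∈       = 𝟘 , 𝟘 , P.𝟘∈ , N.𝟘∈ , λ _ → sym (+-identityʳ 0#)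
        ; ⊕-closed = λ (p , q , p∈ , q∈ , y≐) (p′ , q′ , p′∈ , q′∈ , y′≐) →
            p ⊕ p′ , q ⊕ q′ , P.⊕-closed p∈ p′∈ , N.⊕-closed q∈ q′∈ ,
            λ j → trans (+-cong (y≐ j) (y′≐ j))
              (solve 4 (λ a b c d → (a :+ b) :+ (c :+ d) := (a :+ c) :+ (b :+ d)) refl
                (p j) (q j) (p′ j) (q′ j))
        ; ⊙-closed = λ { {s} 0≤s (p , q , p∈ , q∈ , y≐) →
            s ⊙ p , s ⊙ q , P.⊙-closed 0≤s p∈ , N.⊙-closed 0≤s q∈ ,
            λ j → trans (*-congˡ (y≐ j)) (distribˡ s (p j) (q j)) }
        }

      generator : ∀ {g} → g ∈ G → ∃₂ λ p q → Cone G⁺ p × Cone G⁻ q × g ≐ p ⊕ q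
      generator {g} g∈G with nonneg? g
      ... | yes 0≤fg = g , 𝟘 , generator∈cone (∈-filter⁺ nonneg? g∈G 0≤fg) , N.𝟘∈ , λ j → sym (+-identityʳ (g j))
      ... | no  0≰fg = 𝟘 , g , P.𝟘∈ , generator∈cone (∈-filter⁺ (¬? ∘ nonneg?) g∈G 0≰fg) , λ j → sym (+-identityˡ (g j))

    G⁺⊆ : ∀ {p} → Cone G⁺ p → Cone generators p
    G⁺⊆ = cone-least (cone-convexCone generators)
      (All.tabulate (λ p∈ → generator∈cone (∈-++⁺ˡ p∈)))

    -- For fixed `n`, `crossing n` is linear, so the admissible `p` form a convex cone; for `p` in
    -- `G⁺` the crossing is itself a generator.
    crossing∈ : ∀ {n} → n ∈ G⁻ → ∀ {p} → Cone G⁺ p → Cone generators (crossing n p)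
    crossing∈ {n} n∈ = cone-least convexCone
      (All.tabulate (λ p∈ → generator∈cone (∈-++⁺ʳ G⁺ (∈-cartesianProductWith⁺ crossing n∈ p∈))))
      where
      convexCone : ConvexCone (λ p → Cone generators (crossing n p))
      convexCone = record
        { resp     = λ e → G.resp (λ j → +-cong (*-congʳ (⟦⟧-cong f e)) (-‿cong (*-congˡ (e j))))
        ; 𝟘∈       = G.resp (λ j → sym (trans (+-congʳ (*-congʳ (⟦⟧-𝟘 f)))
            (solve 2 (λ a b → :0 :* a :- b :* :0 := :0) refl (n j) (⟦ f ⟧ n)))) G.𝟘∈
        ; ⊕-closed = λ { {p} {p′} x x′ → G.resp (λ j → sym (trans (+-congʳ (*-congʳ (⟦⟧-⊕ f p p′)))
            (solve 6 (λ a a′ n b p p′ → (a :+ a′) :* n :- b :* (p :+ p′)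
                                     := (a :* n :- b :* p) :+ (a′ :* n :- b :* p′)) refl
              (⟦ f ⟧ p) (⟦ f ⟧ p′) (n j) (⟦ f ⟧ n) (p j) (p′ j))))
            (G.⊕-closed x x′) }
        ; ⊙-closed = λ { {s} {p} 0≤s x → G.resp (λ j → sym (trans (+-congʳ (*-congʳ (⟦⟧-⊙ f s p)))
            (solve 5 (λ s a n b p → s :* a :* n :- b :* (s :* p) := s :* (a :* n :- b :* p)) refl
              s (⟦ f ⟧ p) (n j) (⟦ f ⟧ n) (p j))))
            (G.⊙-closed 0≤s x) }
        }

    -- The form -f defines a half-space containing `G⁻`. An arbitrary `N` inside `G⁻` is allowed
    -- because `absorb` recurses on the tail of the list.
    negative-cone : ∀ {N} → All (_∈ G⁻) N → ∀ {q} → Cone N q → 0# ≤ - 1# * ⟦ f ⟧ q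
    negative-cone N⊆ = cone-least (halfspace-convexCone (multiple (- 1#) f)) (All.map negative N⊆)
      where
      negative : ∀ {n} → n ∈ G⁻ → 0# ≤ - 1# * ⟦ f ⟧ n
      negative {n} n∈ with ≤.total 0# (⟦ f ⟧ n)
      ... | inj₁ 0≤fn = contradiction 0≤fn (proj₂ (∈-filter⁻ (¬? ∘ nonneg?) {xs = G} n∈))
      ... | inj₂ fn≤0 = ≤-by (0≤y-x fn≤0)
        (solve 1 (λ a → :0 :- a := (:- :1) :* a :- :0) refl (⟦ f ⟧ n))

    -- Each generator n of the negative part q is cancelled against a multiple
    -- of p, at the price of a multiple of crossing n p.
    absorb : ∀ {N} → All (_∈ G⁻) N → ∀ {p q} → Cone G⁺ p → Cone N q →
             0# ≤ ⟦ f ⟧ p + ⟦ f ⟧ q → Cone generators (p ⊕ q)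
    absorb [] {p} p∈ ([] q≐𝟘) _ =
      G.resp (λ j → trans (sym (+-identityʳ (p j))) (+-congˡ (sym (q≐𝟘 j)))) (G⁺⊆ p∈)
    absorb (n∈ ∷ N⊆) {p} {q} p∈ (cons {n} {s = s} {q′} 0≤s q′∈ q≐) 0≤fp+fq with s ≤.≤? 0#
    -- A zero coefficient is split off because f p > 0, by which the other case divides, can fail
    -- here.
    ... | yes s≤0 = G.resp (λ j → +-congˡ (sym (q≐q′ j)))
                      (absorb N⊆ p∈ q′∈ (≤.≤-respʳ-≈ (+-congˡ (⟦⟧-cong f q≐q′)) 0≤fp+fq))
      where
      q≐q′ : q ≐ q′
      q≐q′ j = trans (q≐ j) (trans (+-congʳ (trans (*-congʳ (≤.antisym s≤0 0≤s)) (zeroˡ (n j)))) (+-identityˡ (q′ j)))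
    ... | no s>0 = G.resp combination
        (G.⊕-closed (G.⊙-closed (*-nonneg 0≤s 0≤b) (crossing∈ n∈ p∈))
          (absorb N⊆ {θ ⊙ p} (ConvexCone.⊙-closed (cone-convexCone G⁺) 0≤θ p∈) q′∈
            (≤.≤-respʳ-≈ (sym fθp+fq′) 0≤a+sfn+fq′)))
      where
      a = ⟦ f ⟧ p
      fn = ⟦ f ⟧ n

      0≤a+sfn+fq′ : 0# ≤ a + (s * fn + ⟦ f ⟧ q′)
      0≤a+sfn+fq′ = ≤.≤-respʳ-≈ (+-congˡ (trans (⟦⟧-cong f q≐) (⟦⟧-⊙⊕ f s n q′))) 0≤fp+fq

      0≤a+sfn : 0# ≤ a + s * fn
      0≤a+sfn = ≤-by (+-nonneg 0≤a+sfn+fq′ (negative-cone N⊆ q′∈))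
        (solve 3 (λ a b d → a :+ (b :+ d) :+ (:- :1) :* d := a :+ b :- :0) refl a (s * fn) (⟦ f ⟧ q′))

      -- If f p ≤ 0, then s f n ≥ 0, and division by s > 0 would put n on the nonnegative side.
      a>0 : Positive a
      a>0 a≤0 with positive-inverse s>0
      ... | s⁻¹ , 0≤s⁻¹ , ss⁻¹≈1 = proj₂ (∈-filter⁻ (¬? ∘ nonneg?) {xs = G} n∈)
        (≤-by (*-nonneg 0≤s⁻¹ (+-nonneg 0≤a+sfn (0≤y-x a≤0)))
          (trans (solve 4 (λ i a s b → i :* (a :+ s :* b :+ (:0 :- a)) := s :* i :* b :- :0) refl s⁻¹ a s fn)
                 (+-congʳ (trans (*-congʳ ss⁻¹≈1) (*-identityˡ fn)))))

      b = proj₁ (positive-inverse a>0)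
      0≤b = proj₁ (proj₂ (positive-inverse a>0))
      ab≈1 = proj₂ (proj₂ (positive-inverse a>0))

      -- With b = 1 / f p this is 1 + s f n / f p: the share of p that remains once s n has been
      -- completed to `s * b` times `crossing n p`.
      θ : Carrier
      θ = b * (a + s * fn)

      0≤θ : 0# ≤ θ
      0≤θ = *-nonneg 0≤b 0≤a+sfn

      fθp+fq′ : ⟦ f ⟧ (θ ⊙ p) + ⟦ f ⟧ q′ ≈ a + (s * fn + ⟦ f ⟧ q′)
      fθp+fq′ = begin
        ⟦ f ⟧ (θ ⊙ p) + ⟦ f ⟧ q′             ≈⟨ +-congʳ (⟦⟧-⊙ f θ p) ⟩
        θ * a + ⟦ f ⟧ q′                     ≈⟨ solve 4 (λ b a x y → b :* (a :+ x) :* a :+ y := a :* b :* (a :+ x) :+ y) refl b a (s * fn) (⟦ f ⟧ q′) ⟩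
        a * b * (a + s * fn) + ⟦ f ⟧ q′      ≈⟨ +-congʳ (trans (*-congʳ ab≈1) (*-identityˡ _)) ⟩
        (a + s * fn) + ⟦ f ⟧ q′              ≈⟨ +-assoc _ _ _ ⟩
        a + (s * fn + ⟦ f ⟧ q′)              ∎

      combination : (s * b) ⊙ crossing n p ⊕ (θ ⊙ p ⊕ q′) ≐ p ⊕ q
      combination j = begin
        s * b * (a * n j - fn * p j) + (b * (a + s * fn) * p j + q′ j)
          ≈⟨ solve 7 (λ s b a n fn p q′ → s :* b :* (a :* n :- fn :* p) :+ (b :* (a :+ s :* fn) :* p :+ q′)
                        := a :* b :* (p :+ s :* n) :+ q′) refl s b a (n j) fn (p j) (q′ j) ⟩
        a * b * (p j + s * n j) + q′ j     ≈⟨ +-congʳ (trans (*-congʳ ab≈1) (*-identityˡ _)) ⟩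
        (p j + s * n j) + q′ j             ≈⟨ +-assoc _ _ _ ⟩
        p j + (s * n j + q′ j)             ≈⟨ +-congˡ (sym (q≐ j)) ⟩
        p j + q j                          ∎

    complete : ∀ {y} → Cone G y → 0# ≤ ⟦ f ⟧ y → Cone generators y
    complete y∈ 0≤fy with split y∈
    ... | p , q , p∈ , q∈ , y≐ = G.resp (sym ∘ y≐)
      (absorb (All.tabulate (λ n∈ → n∈)) p∈ q∈ (≤.≤-respʳ-≈ (trans (⟦⟧-cong f y≐) (⟦⟧-⊕ f p q)) 0≤fy))

    -- A crossing is the combination of n and p with coefficients f p and -f n, both nonnegative,
    -- and f vanishes on it.
    sound : ∀ {S : Point → Set ℓ₂} → ConvexCone S → All S G →
            All (λ y → S y × 0# ≤ ⟦ f ⟧ y) generators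
    sound {S} S-cone S-G = Allₚ.++⁺ (All.tabulate positive)
      (Allₚ.cartesianProductWith⁺ (≡.setoid Point) (≡.setoid Point) crossing G⁻ G⁺ cross)
      where
      open ConvexCone S-cone

      positive : ∀ {p} → p ∈ G⁺ → S p × 0# ≤ ⟦ f ⟧ p
      positive p∈ with ∈-filter⁻ nonneg? {xs = G} p∈
      ... | p∈G , 0≤fp = All.lookup S-G p∈G , 0≤fp

      cross : ∀ {n p} → n ∈ G⁻ → p ∈ G⁺ → S (crossing n p) × 0# ≤ ⟦ f ⟧ (crossing n p)
      cross {n} {p} n∈ p∈ = resp eq (⊕-closed (⊙-closed 0≤fp (All.lookup S-G n∈G)) (⊙-closed 0≤-fn Sp))
                          , ≤.reflexive (sym f≈0)
        where
        Sp = proj₁ (positive p∈)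
        0≤fp = proj₂ (positive p∈)
        n∈G = proj₁ (∈-filter⁻ (¬? ∘ nonneg?) {xs = G} n∈)
        0≤-fn = negative-cone (n∈ ∷ []) (generator∈cone (here ≡.refl))

        eq : ⟦ f ⟧ p ⊙ n ⊕ (- 1# * ⟦ f ⟧ n) ⊙ p ≐ crossing n p
        eq j = solve 4 (λ a n b p → a :* n :+ (:- :1) :* b :* p := a :* n :- b :* p) refl
                 (⟦ f ⟧ p) (n j) (⟦ f ⟧ n) (p j)

        f≈0 : ⟦ f ⟧ (crossing n p) ≈ 0#
        f≈0 = begin
          ⟦ f ⟧ (crossing n p)                                   ≈⟨ ⟦⟧-cong f (sym ∘ eq) ⟩
          ⟦ f ⟧ (⟦ f ⟧ p ⊙ n ⊕ (- 1# * ⟦ f ⟧ n) ⊙ p)             ≈⟨ ⟦⟧-⊙⊕ f _ n _ ⟩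
          ⟦ f ⟧ p * ⟦ f ⟧ n + ⟦ f ⟧ ((- 1# * ⟦ f ⟧ n) ⊙ p)       ≈⟨ +-congˡ (⟦⟧-⊙ f _ p) ⟩
          ⟦ f ⟧ p * ⟦ f ⟧ n + - 1# * ⟦ f ⟧ n * ⟦ f ⟧ p           ≈⟨ solve 2 (λ a b → a :* b :+ (:- :1) :* b :* a := :0) refl (⟦ f ⟧ p) (⟦ f ⟧ n) ⟩
          0#                                                     ∎

  halfspace∩ : ∀ {S} f → ConvexCone S → FinitelyGenerated S →
               FinitelyGenerated (λ y → S y × 0# ≤ ⟦ f ⟧ y)
  halfspace∩ f S-cone (G , S-G , complete) =
    generators , sound S-cone S-G , λ (Sy , 0≤fy) → HI.complete (complete Sy) 0≤fy
    where
    module HI = HalfspaceIntersection f G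
    open HI using (generators; sound)

  halfspaces-convexCone : ∀ {k} (f : Fin k → LinearForm) → ConvexCone (λ y → ∀ i → 0# ≤ ⟦ f i ⟧ y)
  halfspaces-convexCone f = record
    { resp     = λ e p i → H.resp i e (p i)
    ; 𝟘∈       = λ i → H.𝟘∈ i
    ; ⊕-closed = λ p q i → H.⊕-closed i (p i) (q i)
    ; ⊙-closed = λ 0≤s p i → H.⊙-closed i 0≤s (p i)
    }
    where module H i = ConvexCone (halfspace-convexCone (f i))

  halfspaces∩ : ∀ {k S} (f : Fin k → LinearForm) → ConvexCone S → FinitelyGenerated S →
                FinitelyGenerated (λ y → S y × (∀ i → 0# ≤ ⟦ f i ⟧ y))
  halfspaces∩ {zero} f S-cone (G , S-G , complete) =
    G , All.map (λ Sg → Sg , λ ()) S-G , λ (Sy , _) → complete Sy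
  halfspaces∩ {suc k} f S-cone S-fg
    with halfspaces∩ (f ∘ suc) (∩-convexCone S-cone (halfspace-convexCone (f zero))) (halfspace∩ (f zero) S-cone S-fg)
  ... | G , S-G , complete = G
    , All.map (λ { ((Sg , p₀) , p) → Sg , λ { zero → p₀ ; (suc i) → p i } }) S-G
    , λ (Sy , p) → complete ((Sy , p zero) , p ∘ suc)

  -- Generators of mass at most 0 are the zero point, so the others generate the same cone;
  -- `fixed-point` asks for positive mass of every generator.
  drop-null : ∀ {S} (m : LinearForm) → (∀ {y} → S y → ⟦ m ⟧ y ≤ 0# → y ≐ 𝟘) → FinitelyGenerated S →
              ∃ λ G → All (λ g → S g × Positive (⟦ m ⟧ g)) G × (∀ {y} → S y → Cone G y)
  drop-null {S} m null (G , S-G , complete) = G′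
    , All.tabulate (λ g∈ → let g∈G , m>0 = ∈-filter⁻ positive? {xs = G} g∈ in All.lookup S-G g∈G , m>0)
    , λ Sy → cone-least (cone-convexCone G′) (All.tabulate generator) (complete Sy)
    where
    positive? : ∀ g → Dec (Positive (⟦ m ⟧ g))
    positive? g = ¬? (⟦ m ⟧ g ≤.≤? 0#)
    G′ = filter positive? G

    generator : ∀ {g} → g ∈ G → Cone G′ g
    generator {g} g∈G with ⟦ m ⟧ g ≤.≤? 0#
    ... | yes mg≤0 = ConvexCone.resp (cone-convexCone G′) (sym ∘ null (All.lookup S-G g∈G) mg≤0)
                       (ConvexCone.𝟘∈ (cone-convexCone G′))
    ... | no  mg≰0 = generator∈cone (∈-filter⁺ positive? g∈G mg≰0)

  -- Fixed points of conic relations (Kakutani).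

  record ConvexRelation {ℓ} (R : Point → Point → Set ℓ) : Set (c ⊔ ℓ₁ ⊔ ℓ₂ ⊔ ℓ) where
    field
      resp     : ∀ {y y′ z z′} → y ≐ z → y′ ≐ z′ → R y y′ → R z z′
      ⊕-closed : ∀ {y y′ z z′} → R y y′ → R z z′ → R (y ⊕ z) (y′ ⊕ z′)
      ⊙-closed : ∀ {s y y′} → 0# ≤ s → R y y′ → R (s ⊙ y) (s ⊙ y′)

  module _ (m : LinearForm) where

    mass-nonneg : ∀ {G} → All (Positive ∘ ⟦ m ⟧) G → ∀ {z} → Cone G z → 0# ≤ ⟦ m ⟧ z
    mass-nonneg G>0 = cone-least (halfspace-convexCone m) (All.map positive⇒nonneg G>0)

    -- The mass is a sum of nonnegative terms s m(g) with m(g) > 0, so it vanishes only when every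
    -- coefficient does.
    mass-zero : ∀ {G} → All (Positive ∘ ⟦ m ⟧) G → ∀ {z} → Cone G z → ⟦ m ⟧ z ≤ 0# → z ≐ 𝟘
    mass-zero []          ([] z≐𝟘)                            _     = z≐𝟘
    mass-zero (g>0 ∷ G>0) {y} (cons {g} {s = s} {z} 0≤s z∈ y≐) my≤0 j = begin
      y j              ≈⟨ y≐ j ⟩
      s * g j + z j    ≈⟨ +-cong (*-congʳ s≈0) (mass-zero G>0 z∈ mz≤0 j) ⟩
      0# * g j + 0#    ≈⟨ solve 1 (λ a → :0 :* a :+ :0 := :0) refl (g j) ⟩
      0#               ∎
      where
      smg+mz≤0 : s * ⟦ m ⟧ g + ⟦ m ⟧ z ≤ 0#
      smg+mz≤0 = ≤.≤-respˡ-≈ (trans (⟦⟧-cong m y≐) (⟦⟧-⊙⊕ m s g z)) my≤0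

      smg≤0 : s * ⟦ m ⟧ g ≤ 0#
      smg≤0 = ≤-by (+-nonneg (0≤y-x smg+mz≤0) (mass-nonneg G>0 z∈))
        (solve 2 (λ a b → :0 :- (a :+ b) :+ b := :0 :- a) refl (s * ⟦ m ⟧ g) (⟦ m ⟧ z))

      mz≤0 : ⟦ m ⟧ z ≤ 0#
      mz≤0 = ≤-by (+-nonneg (0≤y-x smg+mz≤0) (*-nonneg 0≤s (positive⇒nonneg g>0)))
        (solve 2 (λ a b → :0 :- (a :+ b) :+ a := :0 :- b) refl (s * ⟦ m ⟧ g) (⟦ m ⟧ z))

      s≈0 : s ≈ 0#
      s≈0 with s ≤.≤? 0#
      ... | yes s≤0 = ≤.antisym s≤0 0≤s
      ... | no  s>0 = contradiction smg≤0 (positive-* s>0 g>0)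

    -- Kakutani's theorem for a relation whose graph is a convex cone.  The
    -- generator g is eliminated as a state of a Markov chain is: it is related
    -- to s g + z, so that a walk through g leaves it with total weight 1 / (1 − s).
    fixed-point : ∀ {ℓ} {R : Point → Point → Set ℓ} → ConvexRelation R →
      ∀ {G} → All (Positive ∘ ⟦ m ⟧) G →
      All (λ g → ∃ λ g′ → R g g′ × Cone G g′ × ⟦ m ⟧ g′ ≈ ⟦ m ⟧ g) G →
      (∃ λ y → Cone G y × Positive (⟦ m ⟧ y)) →
      ∃ λ y → Cone G y × Positive (⟦ m ⟧ y) × R y y
    fixed-point R-cone [] [] (y , [] y≐𝟘 , my>0) =
      contradiction (≤.reflexive (trans (⟦⟧-cong m y≐𝟘) (⟦⟧-𝟘 m))) my>0
    fixed-point {R = R} R-cone {g ∷ G} (g>0 ∷ G>0) ((g′ , Rgg′ , cons {s = s} {z} 0≤s z∈ g′≐ , mg′≈mg) ∷ images) _ =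
      eliminate ((1# - s) ≤.≤? 0#)
      where
      open ConvexRelation R-cone
      module C = ConvexCone (cone-convexCone G)

      mz≈ : ⟦ m ⟧ z ≈ (1# - s) * ⟦ m ⟧ g
      mz≈ = begin
        ⟦ m ⟧ z                                       ≈⟨ solve 2 (λ a b → a := (b :+ a) :- b) refl (⟦ m ⟧ z) (s * ⟦ m ⟧ g) ⟩
        (s * ⟦ m ⟧ g + ⟦ m ⟧ z) - s * ⟦ m ⟧ g         ≈⟨ +-congʳ (sym (trans (⟦⟧-cong m g′≐) (⟦⟧-⊙⊕ m s g z))) ⟩
        ⟦ m ⟧ g′ - s * ⟦ m ⟧ g                        ≈⟨ +-congʳ mg′≈mg ⟩
        ⟦ m ⟧ g - s * ⟦ m ⟧ g                         ≈⟨ solve 2 (λ a s → a :- s :* a := (:1 :- s) :* a) refl (⟦ m ⟧ g) s ⟩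
        (1# - s) * ⟦ m ⟧ g                            ∎

      -- If s ≥ 1, the mass (1 - s) m(g) of z is at most 0, so z = 0; as that mass is also
      -- nonnegative, s = 1. Thus g is already a fixed point.
      absorbing : 1# - s ≤ 0# → g′ ≐ g
      absorbing 1-s≤0 j = begin
        g′ j             ≈⟨ g′≐ j ⟩
        s * g j + z j    ≈⟨ +-cong (*-congʳ s≈1) (mass-zero G>0 z∈ mz≤0 j) ⟩
        1# * g j + 0#    ≈⟨ solve 1 (λ a → :1 :* a :+ :0 := a) refl (g j) ⟩
        g j              ∎
        where
        mz≤0 : ⟦ m ⟧ z ≤ 0#
        mz≤0 = ≤-by (*-nonneg (0≤y-x 1-s≤0) (positive⇒nonneg g>0))
          (trans (solve 2 (λ s a → (:0 :- (:1 :- s)) :* a := :0 :- (:1 :- s) :* a) refl s (⟦ m ⟧ g))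
                 (+-congˡ (-‿cong (sym mz≈))))

        s≈1 : s ≈ 1#
        s≈1 with (s - 1#) ≤.≤? 0#
        ... | no  s-1>0 = contradiction (≤-by (mass-nonneg G>0 z∈)
                (trans mz≈ (solve 2 (λ s a → (:1 :- s) :* a := :0 :- (s :- :1) :* a) refl s (⟦ m ⟧ g))))
                (positive-* s-1>0 g>0)
        ... | yes s-1≤0 = ≤.antisym (≤-by (0≤y-x s-1≤0) (solve 1 (λ s → :0 :- (s :- :1) := :1 :- s) refl s))
                                    (≤-by (0≤y-x 1-s≤0) (solve 1 (λ s → :0 :- (:1 :- s) := s :- :1) refl s))

      eliminate : Dec (1# - s ≤ 0#) → ∃ λ y → Cone (g ∷ G) y × Positive (⟦ m ⟧ y) × R y y
      eliminate (yes 1-s≤0) = g , generator∈cone (here ≡.refl) , g>0 , resp (λ _ → refl) (absorbing 1-s≤0) Rgg′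
      eliminate (no  1-s>0) = extend (fixed-point censored-cone G>0 (All.map censored-image images)
        -- The point z, of mass (1 - s) m(g) > 0, shows that the smaller cone is not zero.
        (z , z∈ , λ mz≤0 → positive-* 1-s>0 g>0 (≤.≤-respˡ-≈ mz≈ mz≤0)))
        where
        w = proj₁ (positive-inverse 1-s>0)
        0≤w = proj₁ (proj₂ (positive-inverse 1-s>0))
        [1-s]w≈1 = proj₂ (proj₂ (positive-inverse 1-s>0))

        -- The walk watched only off g: the same multiple of g is added on both sides, so a point y
        -- related to itself here yields the fixed point t g + y of `R`.
        Censored : Point → Point → Set _
        Censored y y′ = ∃ λ t → 0# ≤ t × R (t ⊙ g ⊕ y) (t ⊙ g ⊕ y′)

        censored-cone : ConvexRelation Censored
        censored-cone = record
          { resp     = λ e e′ (t , 0≤t , r) → t , 0≤t , resp (λ j → +-congˡ (e j)) (λ j → +-congˡ (e′ j)) r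
          ; ⊕-closed = λ { {y} {y′} {x} {x′} (t , 0≤t , r) (t′ , 0≤t′ , r′) →
              t + t′ , +-nonneg 0≤t 0≤t′ , resp (add t t′ y x) (add t t′ y′ x′) (⊕-closed r r′) }
          ; ⊙-closed = λ { {a} {y} {y′} 0≤a (t , 0≤t , r) →
              a * t , *-nonneg 0≤a 0≤t , resp (scale a t y) (scale a t y′) (⊙-closed 0≤a r) }
          }
          where
          add : ∀ t t′ y x → (t ⊙ g ⊕ y) ⊕ (t′ ⊙ g ⊕ x) ≐ (t + t′) ⊙ g ⊕ (y ⊕ x)
          add t t′ y x j = solve 5 (λ t t′ g y x → (t :* g :+ y) :+ (t′ :* g :+ x) := (t :+ t′) :* g :+ (y :+ x))
            refl t t′ (g j) (y j) (x j)
          scale : ∀ a t y → a ⊙ (t ⊙ g ⊕ y) ≐ (a * t) ⊙ g ⊕ a ⊙ y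
          scale a t y j = solve 4 (λ a t g y → a :* (t :* g :+ y) := a :* t :* g :+ a :* y) refl a t (g j) (y j)

        censored-image : ∀ {h} → (∃ λ h′ → R h h′ × Cone (g ∷ G) h′ × ⟦ m ⟧ h′ ≈ ⟦ m ⟧ h) →
                         ∃ λ h′ → Censored h h′ × Cone G h′ × ⟦ m ⟧ h′ ≈ ⟦ m ⟧ h
        censored-image {h} (h′ , Rhh′ , cons {s = s′} {z′} 0≤s′ z′∈ h′≐ , mh′≈mh) =
          t ⊙ z ⊕ z′
          , (t , 0≤t , resp (λ _ → refl) related (⊕-closed (⊙-closed 0≤t Rgg′) Rhh′))
          , C.⊕-closed (C.⊙-closed 0≤t z∈) z′∈
          , mass
          where
          -- This is s′ / (1 - s), the solution of t = t s + s′, so that g has coefficient t on both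
          -- sides.
          t = s′ * w
          0≤t = *-nonneg 0≤s′ 0≤w

          t[1-s]≈s′ : t * (1# - s) ≈ s′
          t[1-s]≈s′ = trans (solve 3 (λ s′ w s → s′ :* w :* (:1 :- s) := (:1 :- s) :* w :* s′) refl s′ w s)
                            (trans (*-congʳ [1-s]w≈1) (*-identityˡ s′))

          related : t ⊙ g′ ⊕ h′ ≐ t ⊙ g ⊕ (t ⊙ z ⊕ z′)
          related j = begin
            t * g′ j + h′ j
              ≈⟨ +-cong (*-congˡ (g′≐ j)) (h′≐ j) ⟩
            t * (s * g j + z j) + (s′ * g j + z′ j)
              ≈⟨ +-congˡ (+-congʳ (*-congʳ (sym t[1-s]≈s′))) ⟩
            t * (s * g j + z j) + (t * (1# - s) * g j + z′ j)
              ≈⟨ solve 5 (λ t s g z z′ → t :* (s :* g :+ z) :+ (t :* (:1 :- s) :* g :+ z′)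
                                      := t :* g :+ (t :* z :+ z′)) refl t s (g j) (z j) (z′ j) ⟩
            t * g j + (t * z j + z′ j)
              ∎

          mass : ⟦ m ⟧ (t ⊙ z ⊕ z′) ≈ ⟦ m ⟧ h
          mass = begin
            ⟦ m ⟧ (t ⊙ z ⊕ z′)                         ≈⟨ ⟦⟧-⊙⊕ m t z z′ ⟩
            t * ⟦ m ⟧ z + ⟦ m ⟧ z′                     ≈⟨ +-congʳ (trans (*-congˡ mz≈) (sym (*-assoc _ _ _))) ⟩
            t * (1# - s) * ⟦ m ⟧ g + ⟦ m ⟧ z′          ≈⟨ +-congʳ (*-congʳ t[1-s]≈s′) ⟩
            s′ * ⟦ m ⟧ g + ⟦ m ⟧ z′                    ≈⟨ sym (trans (⟦⟧-cong m h′≐) (⟦⟧-⊙⊕ m s′ g z′)) ⟩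
            ⟦ m ⟧ h′                                   ≈⟨ mh′≈mh ⟩
            ⟦ m ⟧ h                                    ∎

        extend : (∃ λ y → Cone G y × Positive (⟦ m ⟧ y) × Censored y y) →
                 ∃ λ y → Cone (g ∷ G) y × Positive (⟦ m ⟧ y) × R y y
        extend (y , y∈ , my>0 , t , 0≤t , r) = t ⊙ g ⊕ y , cons 0≤t y∈ (λ _ → refl) , positive , r
          where
          positive : Positive (⟦ m ⟧ (t ⊙ g ⊕ y))
          positive m≤0 = my>0 (≤-by (+-nonneg (0≤y-x m≤0) (*-nonneg 0≤t (positive⇒nonneg g>0)))
            (trans (+-congʳ (+-congˡ (-‿cong (⟦⟧-⊙⊕ m t g y))))
              (solve 2 (λ a b → :0 :- (a :+ b) :+ a := :0 :- b) refl (t * ⟦ m ⟧ g) (⟦ m ⟧ y))))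

-- The nonnegative orthant as a finitely generated cone.

module _ {c ℓ₁ ℓ₂} (F : OrderedField c ℓ₁ ℓ₂) where

  open OrderedField F hiding (zero)
  open OrderedFieldProperties F
  open Cones F

  Nonnegative : ∀ {N} → (Fin N → Carrier) → Set ℓ₂
  Nonnegative y = ∀ j → 0# ≤ y j

  -- The generators are the unit vectors, built by induction on the dimension; `K` is cut from this
  -- cone by half-spaces.
  orthant : ∀ N → FinitelyGenerated (Fin N) Nonnegative
  orthant zero    = [] , [] , λ _ → [] λ ()
  orthant (suc N) with orthant N
  ... | G , G≥0 , complete = e₀ ∷ map shift G
    , (λ { zero → 0≤1 ; (suc j) → ≤.refl })
      ∷ Allₚ.map⁺ (All.map (λ g≥0 → λ { zero → ≤.refl ; (suc j) → g≥0 j }) G≥0)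
    , λ {y} y≥0 → cons (y≥0 zero) (shift∈ (complete (y≥0 ∘ suc)))
        (λ { zero    → solve 1 (λ a → a := a :* :1 :+ :0) refl (y zero)
           ; (suc j) → solve 2 (λ a b → b := a :* :0 :+ b) refl (y zero) (y (suc j)) })
    where
    e₀ : Fin (suc N) → Carrier
    e₀ zero    = 1#
    e₀ (suc j) = 0#

    shift : (Fin N → Carrier) → Fin (suc N) → Carrier
    shift z zero    = 0#
    shift z (suc j) = z j

    shift∈ : ∀ {z} → Cone (Fin N) G z → Cone (Fin (suc N)) (map shift G) (shift z)
    shift∈ = cone-least (Fin N) convexCone
      (All.tabulate (λ g∈ → generator∈cone (Fin (suc N)) (∈-map⁺ shift g∈)))
      where
      module C = ConvexCone (Fin (suc N)) (cone-convexCone (Fin (suc N)) (map shift G))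

      convexCone : ConvexCone (Fin N) (λ z → Cone (Fin (suc N)) (map shift G) (shift z))
      convexCone = record
        { resp     = λ e → C.resp (λ { zero → refl ; (suc j) → e j })
        ; 𝟘∈       = C.resp (λ { zero → refl ; (suc j) → refl }) C.𝟘∈
        ; ⊕-closed = λ p q → C.resp (λ { zero → +-identityʳ 0# ; (suc j) → refl }) (C.⊕-closed p q)
        ; ⊙-closed = λ { {s} 0≤s p → C.resp (λ { zero → zeroʳ s ; (suc j) → refl }) (C.⊙-closed 0≤s p) }
        }

-- Position distributions below given caps.

module Positions {c ℓ₁ ℓ₂} (F : OrderedField c ℓ₁ ℓ₂) where

  open OrderedField F hiding (zero)
  open OrderedFieldProperties F
  open import Relation.Binary.Reasoning.Setoid setoid

  totalOrder : TotalOrder _ _ _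
  totalOrder = record { isTotalOrder = ≤.isTotalOrder }

  open Min totalOrder using (_⊓_; x⊓y≤x; x⊓y≤y; ⊓-glb)

  module _ {n m : ℕ} (X : Fin n → Fin n → Carrier) (a : Fin n → Carrier)
           (W : Fin n → Fin (suc m) → Carrier) where

    -- The index i : Fin (suc m) stands for the position i + 1.
    record IsPositions (y : Fin n → Fin (suc m) → Carrier) : Set (ℓ₁ ⊔ ℓ₂) where
      field
        nonneg    : ∀ v i → 0# ≤ y v i
        capped    : ∀ v i → y v i ≤ W v i
        total     : ∀ v → sum (y v) ≈ 1#
        from-root : ∀ v → a v ≤ y v zero
        along     : ∀ u v i → y u (inject₁ i) + X u v ≤ y v (suc i) + 1#

    open Cones F (Fin (suc (n ℕ.* suc m)))
    open LinearForm

    at : Fin n → Fin (suc m) → Fin (suc (n ℕ.* suc m))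
    at v i = suc (combine v i)

    scale : LinearForm
    scale = coordinate zero

    point : Carrier → (Fin n → Fin (suc m) → Carrier) → Point
    point t Y zero    = t
    point t Y (suc j) = uncurry Y (remQuot (suc m) j)

    point-at : ∀ t Y v i → point t Y (at v i) ≡ Y v i
    point-at t Y v i = ≡.cong (uncurry Y) (remQuot-combine v i)

    sum-point-at : ∀ t Y v → sum (λ i → point t Y (at v i)) ≈ sum (Y v)
    sum-point-at t Y v = sum-cong-≋ (λ i → reflexive (point-at t Y v i))

    cap : Fin (n ℕ.* suc m) → LinearForm
    cap j = multiple (uncurry W (remQuot (suc m) j)) scale ⊖ coordinate (suc j)

    -- Two opposite half-spaces encode the equation between total mass and scale, since cones are
    -- cut by half-spaces only.
    surplus deficit : Fin n → LinearForm
    surplus v = ∑ᶠ (λ i → coordinate (at v i)) ⊖ scale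
    deficit v = scale ⊖ ∑ᶠ (λ i → coordinate (at v i))

    -- The cone over the set of families (y v) of probability vectors below W,
    -- the scale being the coordinate zero.
    K : Point → Set ℓ₂
    K y = ((Nonnegative F y × (∀ j → 0# ≤ ⟦ cap j ⟧ y))
        × (∀ v → 0# ≤ ⟦ surplus v ⟧ y)) × (∀ v → 0# ≤ ⟦ deficit v ⟧ y)

    K-convexCone : ConvexCone K
    K-convexCone = ∩-convexCone (∩-convexCone (∩-convexCone (halfspaces-convexCone coordinate)
      (halfspaces-convexCone cap)) (halfspaces-convexCone surplus)) (halfspaces-convexCone deficit)

    K-finitelyGenerated : FinitelyGenerated K
    K-finitelyGenerated =
      halfspaces∩ deficit (∩-convexCone (∩-convexCone (halfspaces-convexCone coordinate)
        (halfspaces-convexCone cap)) (halfspaces-convexCone surplus))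
        (halfspaces∩ surplus (∩-convexCone (halfspaces-convexCone coordinate) (halfspaces-convexCone cap))
          (halfspaces∩ cap (halfspaces-convexCone coordinate) (orthant F _)))

    K-nonneg : ∀ {y} → K y → ∀ j → 0# ≤ y j
    K-nonneg (((y≥0 , _) , _) , _) = y≥0

    K-capped : ∀ {y} → K y → ∀ v i → y (at v i) ≤ W v i * y zero
    K-capped {y} (((_ , capped) , _) , _) v i =
      ≤.≤-respʳ-≈ (*-congʳ (reflexive (≡.cong (uncurry W) (remQuot-combine v i))))
        (≤-by (capped (combine v i)) refl)

    K-total : ∀ {y} → K y → ∀ v → sum (λ i → y (at v i)) ≈ y zero
    K-total ((_ , surplus≥0) , deficit≥0) v = ≤.antisym (≤-by (deficit≥0 v) refl) (≤-by (surplus≥0 v) refl)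

    K-point : ∀ {t Y} → 0# ≤ t → (∀ v i → 0# ≤ Y v i) → (∀ v i → Y v i ≤ W v i * t) →
              (∀ v → sum (Y v) ≈ t) → K (point t Y)
    K-point {t} {Y} 0≤t Y≥0 Y≤W total =
      (( (λ { zero → 0≤t ; (suc j) → uncurry Y≥0 (remQuot (suc m) j) })
       , (λ j → 0≤y-x (uncurry Y≤W (remQuot (suc m) j))))
       , (λ v → 0≤y-x (≤.reflexive (sym (total′ v)))))
       , (λ v → 0≤y-x (≤.reflexive (total′ v)))
      where
      total′ : ∀ v → sum (λ i → point t Y (at v i)) ≈ t
      total′ v = trans (sum-point-at t Y v) (total v)

    -- At scale 0 the caps bound every other coordinate by 0. This is the boundedness of the
    -- polytope behind `K`, in the form that `drop-null` asks for.
    K-null : ∀ {y} → K y → y zero ≤ 0# → y ≐ 𝟘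
    K-null y∈K t≤0 zero = ≤.antisym t≤0 (K-nonneg y∈K zero)
    K-null {y} y∈K@(((_ , capped) , _) , _) t≤0 (suc j) = ≤.antisym
      (≤.≤-respʳ-≈ (trans (*-congˡ (≤.antisym t≤0 (K-nonneg y∈K zero))) (zeroʳ _)) (≤-by (capped j) refl))
      (K-nonneg y∈K (suc j))

    -- The last two conditions of `IsPositions`, made homogeneous by the scale of `y` and read as a
    -- relation between two points. A point related to itself satisfies both.
    record Follows (y y′ : Point) : Set ℓ₂ where
      field
        from-root : ∀ v → a v * y zero ≤ y′ (at v zero)
        along     : ∀ u v i → y (at u (inject₁ i)) + X u v * y zero ≤ y′ (at v (suc i)) + y zero

    follows-convex : ConvexRelation Follows
    follows-convex = record
      { resp = λ e e′ r → record
        { from-root = λ v → ≤.≤-respˡ-≈ (*-congˡ (e zero)) (≤.≤-respʳ-≈ (e′ _) (from-root r v))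
        ; along = λ u v i → ≤.≤-respˡ-≈ (+-cong (e _) (*-congˡ (e zero)))
                              (≤.≤-respʳ-≈ (+-cong (e′ _) (e zero)) (along r u v i))
        }
      ; ⊕-closed = λ { {y} {y′} {z} {z′} r q → record
        { from-root = λ v → ≤.≤-respˡ-≈ (sym (distribˡ (a v) (y zero) (z zero)))
                              (+-mono-≤ (from-root r v) (from-root q v))
        ; along = λ u v i → ≤-by (0≤y-x (+-mono-≤ (along r u v i) (along q u v i)))
            (solve 7 (λ p q x t s p′ q′ → ((p′ :+ t) :+ (q′ :+ s)) :- ((p :+ x :* t) :+ (q :+ x :* s))
                                       := (p′ :+ q′) :+ (t :+ s) :- ((p :+ q) :+ x :* (t :+ s))) refl
              (y (at u (inject₁ i))) (z (at u (inject₁ i))) (X u v) (y zero) (z zero)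
              (y′ (at v (suc i))) (z′ (at v (suc i))))
        } }
      ; ⊙-closed = λ { {s} {y} {y′} 0≤s r → record
        { from-root = λ v → ≤.≤-respˡ-≈ (solve 3 (λ s a t → s :* (a :* t) := a :* (s :* t)) refl s (a v) (y zero))
                              (*-monoˡ-≤ 0≤s (from-root r v))
        ; along = λ u v i → ≤-by (0≤y-x (*-monoˡ-≤ 0≤s (along r u v i)))
            (solve 5 (λ s p x t p′ → s :* (p′ :+ t) :- s :* (p :+ x :* t)
                                  := (s :* p′ :+ s :* t) :- (s :* p :+ x :* (s :* t))) refl
              s (y (at u (inject₁ i))) (X u v) (y zero) (y′ (at v (suc i))))
        } }
      }
      where open Follows

    -- Existence of positions from inflow and cap inequalities.

    module _ (X≥0 : ∀ u v → 0# ≤ X u v) (a≥0 : ∀ v → 0# ≤ a v)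
             (inflow≤1 : ∀ v → a v + sum (λ u → X u v) ≤ 1#)
             (W≥0 : ∀ v i → 0# ≤ W v i) (W₀≈1 : ∀ v → W v zero ≈ 1#)
             (W-along : ∀ u v i → W u (inject₁ i) + X u v ≤ W v (suc i) + 1#) where

      X≤1 : ∀ u v → X u v ≤ 1#
      X≤1 u v = ≤.trans (term≤sum (λ u → X≥0 u v) u)
        (≤-by (+-nonneg (a≥0 v) (0≤y-x (inflow≤1 v)))
          (solve 3 (λ a s o → a :+ (o :- (a :+ s)) := o :- s) refl (a v) (sum (λ u → X u v)) 1#))

      -- Every node copies its predecessors one position later, each with weight
      -- X; what exceeds the caps or is not copied goes to the first position.
      module Image {y} (y∈K : K y) where

        t = y zero

        0≤t : 0# ≤ t
        0≤t = K-nonneg y∈K zero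

        copied : Fin n → Fin m → Carrier
        copied v i = sum (λ u → X u v * y (at u (inject₁ i)))

        later : Fin n → Fin m → Carrier
        later v i = (W v (suc i) * t) ⊓ copied v i

        image : Fin n → Fin (suc m) → Carrier
        image v zero    = t - sum (later v)
        image v (suc i) = later v i

        copied-term≥0 : ∀ v i u → 0# ≤ X u v * y (at u (inject₁ i))
        copied-term≥0 v i u = *-nonneg (X≥0 u v) (K-nonneg y∈K _)

        later≥0 : ∀ v i → 0# ≤ later v i
        later≥0 v i = ⊓-glb (*-nonneg (W≥0 v (suc i)) 0≤t) (sum-nonneg (copied-term≥0 v i))

        -- Mass at the last position has no later position to be copied to, so it is dropped.
        sum-init≤t : ∀ u → sum (λ i → y (at u (inject₁ i))) ≤ t
        sum-init≤t u = ≤-by (K-nonneg y∈K (at u (fromℕ m)))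
          (trans (solve 2 (λ s l → l := (s :+ l) :- s) refl _ _)
                 (+-congʳ (trans (sym (sum-init-last (λ i → y (at u i)))) (K-total y∈K u))))

        -- After exchanging the sums, each predecessor u contributes X u v times its mass outside
        -- the last position.
        sum-copied : ∀ v → sum (copied v) ≤ sum (λ u → X u v) * t
        sum-copied v = ≤.≤-respˡ-≈ (sym swap) (≤.≤-respʳ-≈ (sym (*-distribʳ-sum t (λ u → X u v)))
          (sum-mono-≤ (λ u → *-monoˡ-≤ (X≥0 u v) (sum-init≤t u))))
          where
          swap : sum (copied v) ≈ sum (λ u → X u v * sum (λ i → y (at u (inject₁ i))))
          swap = trans (∑-comm (λ i u → X u v * y (at u (inject₁ i))))
                       (sum-cong-≋ (λ u → sym (*-distribˡ-sum (X u v) (λ i → y (at u (inject₁ i))))))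

        -- The copied mass is at most t times the sum of the X u v, so `inflow≤1` leaves at least a
        -- v t for the first position.
        image₀≥at : ∀ v → a v * t ≤ image v zero
        image₀≥at v = ≤-by
          (+-nonneg (*-nonneg 0≤t (0≤y-x (inflow≤1 v)))
            (+-nonneg (0≤y-x (sum-copied v))
                      (0≤y-x (sum-mono-≤ {f = later v} {copied v} (λ i → x⊓y≤y (W v (suc i) * t) (copied v i))))))
          (solve 5 (λ t a S C L → t :* (:1 :- (a :+ S)) :+ ((S :* t :- C) :+ (C :- L)) := t :- L :- a :* t) refl
            t (a v) (sum (λ u → X u v)) (sum (copied v)) (sum (later v)))

        image≥0 : ∀ v i → 0# ≤ image v i
        image≥0 v zero    = ≤.trans (*-nonneg (a≥0 v) 0≤t) (image₀≥at v)
        image≥0 v (suc i) = later≥0 v i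

        image-capped : ∀ v i → image v i ≤ W v i * t
        image-capped v zero = ≤-by (sum-nonneg (later≥0 v))
          (trans (solve 2 (λ t L → L := :1 :* t :- (t :- L)) refl t (sum (later v)))
                 (+-congʳ (*-congʳ (sym (W₀≈1 v)))))
        image-capped v (suc i) = x⊓y≤x _ _

        image-total : ∀ v → sum (image v) ≈ t
        image-total v = solve 2 (λ t L → (t :- L) :+ L := t) refl t (sum (later v))

        -- Both entries of the minimum defining later v i dominate y + t (X − 1): the
        -- second one because (t − y) (1 − X) ≥ 0.
        image-along : ∀ u v i → y (at u (inject₁ i)) + X u v * t ≤ later v i + t
        image-along u v i = ≤-by (0≤y-x (⊓-glb cap-bound copy-bound))
          (solve 3 (λ L p t → L :- (p :- t) := (L :+ t) :- p) refl (later v i) (y (at u (inject₁ i)) + X u v * t) t)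
          where
          w = y (at u (inject₁ i))

          -- Obtained from `W-along` scaled by t and the cap on w.
          cap-bound : (w + X u v * t) - t ≤ W v (suc i) * t
          cap-bound = ≤-by
            (+-nonneg (*-nonneg 0≤t (0≤y-x (W-along u v i))) (0≤y-x (K-capped y∈K u (inject₁ i))))
            (solve 5 (λ t W W′ x w → t :* ((W′ :+ :1) :- (W :+ x)) :+ (W :* t :- w)
                                  := W′ :* t :- ((w :+ x :* t) :- t)) refl
              t (W u (inject₁ i)) (W v (suc i)) (X u v) w)

          w≤t : w ≤ t
          w≤t = ≤.≤-respʳ-≈ (K-total y∈K u) (term≤sum {f = λ i → y (at u i)} (λ i → K-nonneg y∈K (at u i)) (inject₁ i))

          copy-bound : (w + X u v * t) - t ≤ copied v i
          copy-bound = ≤.trans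
            (≤-by (*-nonneg (0≤y-x w≤t) (0≤y-x (X≤1 u v)))
              (solve 3 (λ t w x → (t :- w) :* (:1 :- x) := x :* w :- ((w :+ x :* t) :- t)) refl t w (X u v)))
            (term≤sum {f = λ u → X u v * y (at u (inject₁ i))} (copied-term≥0 v i) u)

        image∈K : K (point t image)
        image∈K = K-point 0≤t image≥0 image-capped image-total

        follows : Follows y (point t image)
        follows = record
          { from-root = λ v → ≤.≤-respʳ-≈ (reflexive (≡.sym (point-at t image v zero))) (image₀≥at v)
          ; along     = λ u v i → ≤.≤-respʳ-≈ (+-congʳ (reflexive (≡.sym (point-at t image v (suc i))))) (image-along u v i)
          }

      -- All mass at position 1, where the cap is 1: a point of `K` of positive scale, as needed to
      -- start `fixed-point`.
      first : Fin n → Fin (suc m) → Carrier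
      first v zero    = 1#
      first v (suc i) = 0#

      first∈K : K (point 1# first)
      first∈K = K-point 0≤1
        (λ { v zero → 0≤1 ; v (suc i) → ≤.refl })
        (λ { v zero → ≤.reflexive (trans (sym (W₀≈1 v)) (sym (*-identityʳ _)))
           ; v (suc i) → *-nonneg (W≥0 v (suc i)) 0≤1 })
        (λ v → trans (+-congˡ (sum-replicate-zero m)) (+-identityʳ 1#))

      -- Division by the scale undoes the homogenisation; `Follows y y` supplies `from-root` and
      -- `along`.
      normalise : ∀ {y} → K y → Positive (y zero) → Follows y y → ∃ IsPositions
      normalise {y} y∈K t>0 y→y = (λ v i → b * y (at v i)) , record
        { nonneg    = λ v i → *-nonneg 0≤b (K-nonneg y∈K (at v i))
        ; capped    = λ v i → ≤.≤-respʳ-≈ (rescale (W v i)) (*-monoˡ-≤ 0≤b (K-capped y∈K v i))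
        ; total     = λ v → trans (sym (*-distribˡ-sum b (λ i → y (at v i))))
                              (trans (*-congˡ (K-total y∈K v)) (trans (*-comm b (y zero)) tb≈1))
        ; from-root = λ v → ≤.≤-respˡ-≈ (rescale (a v)) (*-monoˡ-≤ 0≤b (from-root v))
        ; along     = λ u v i →
            ≤.≤-respˡ-≈ (trans (distribˡ b _ _) (+-congˡ (rescale (X u v))))
              (≤.≤-respʳ-≈ (trans (distribˡ b _ _) (+-congˡ (trans (*-comm b (y zero)) tb≈1)))
                (*-monoˡ-≤ 0≤b (along u v i)))
        }
        where
        open Follows y→y
        b = proj₁ (positive-inverse t>0)
        0≤b = proj₁ (proj₂ (positive-inverse t>0))
        tb≈1 = proj₂ (proj₂ (positive-inverse t>0))

        rescale : ∀ s → b * (s * y zero) ≈ s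
        rescale s = trans (solve 3 (λ b s t → b :* (s :* t) := t :* b :* s) refl b s (y zero))
                          (trans (*-congʳ tb≈1) (*-identityˡ s))

      positions : ∃ IsPositions
      positions with drop-null scale K-null K-finitelyGenerated
      ... | G , G-K , complete
        with fixed-point scale follows-convex (All.map proj₂ G-K)
               -- Each generator is sent to its image, which keeps the scale t by definition; hence
               -- the final `refl`.
               (All.map (λ (g∈K , _) → let open Image g∈K in point t image , follows , complete image∈K , refl) G-K)
               (point 1# first , complete first∈K , 1≰0)
      ... | y , y∈ , t>0 , y→y = normalise (cone-least K-convexCone (All.map proj₁ G-K) y∈) t>0 y→y

-- From the partial-ordering polytope to the assignment polytope.

module Inclusion {c ℓ₁ ℓ₂} (F : OrderedField c ℓ₁ ℓ₂) {n : ℕ} (r : Fin n) (m : ℕ) where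

  open OrderedField F hiding (zero)
  open OrderedFieldProperties F
  open Polytopes F n r (suc m)
  open Positions F

  module _ {x : ArcVector} {l : V → Index → Carrier} {g : Index → V → Carrier} (p : 𝒫 x l g) where

    open 𝒫 p
    open Common common

    sum≤∑-over : ∀ {q} {P : Pred V q} (P? : Decidable P) {f : (u : V) → .(P u) → Carrier} {w : V → Carrier} →
      (∀ u (pu : P u) → w u ≤ f u pu) → (∀ u → ¬ P u → w u ≤ 0#) → sum w ≤ ∑-over P? f
    sum≤∑-over P? {f} {w} on off = sum-mono-≤ bound
      where
      -- Gives a name to the summand, which is local to the definition of ∑-over.
      summand : ∃ λ t → ∑-over P? f ≡ sum t
      summand = _ , ≡.refl

      bound : ∀ u → w u ≤ proj₁ summand u
      bound u with P? u
      ... | yes pu = on u pu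
      ... | no ¬pu = off u ¬pu

    -- Arcs at the root get weight 0: those out of it are accounted for by `a`, and those into it
    -- have x ≤ 0 by `into-root`. The decisions are arguments so that proofs can match on them.
    weight : ∀ {u v} → Dec (u ≡ v) → Dec (u ≡ r) → Dec (v ≡ r) → Carrier
    weight {u} {v} (no u≢v) (no _) (no _) = x u v u≢v
    weight _ _ _ = 0#

    X : V → V → Carrier
    X u v = weight (u ≟ v) (u ≟ r) (v ≟ r)

    rootWeight : ∀ {v} → Dec (v ≡ r) → Carrier
    rootWeight {v} (no v≢r) = x r v (v≢r ∘ ≡.sym)
    rootWeight (yes _) = 0#

    a : V → Carrier
    a v = rootWeight (v ≟ r)

    -- Index i stands for position i + 1, hence the shift in `l`. The root is kept as an isolated
    -- node with all caps 1, which spares `IsPositions` an exception.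
    survival : ∀ {v} → Dec (v ≡ r) → Fin (suc m) → Carrier
    survival {v} (no _)  i = 1# - l v (suc i)
    survival     (yes _) i = 1#

    W : V → Fin (suc m) → Carrier
    W v = survival (v ≟ r)

    X≥0 : ∀ u v → 0# ≤ X u v
    X≥0 u v with u ≟ v | u ≟ r | v ≟ r
    ... | no u≢v | no _  | no _  = proj₁ (X3 u v u≢v)
    ... | no _   | no _  | yes _ = ≤.refl
    ... | no _   | yes _ | _     = ≤.refl
    ... | yes _  | _     | _     = ≤.refl

    a≥0 : ∀ v → 0# ≤ a v
    a≥0 v with v ≟ r
    ... | no v≢r = proj₁ (X3 r v (v≢r ∘ ≡.sym))
    ... | yes _  = ≤.refl

    -- This is `X1`, with a v counted as the term u = r, where X r v is 0; the comparison with x is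
    -- then termwise.
    inflow-bound : ∀ v → a v + sum (λ u → X u v) ≤ 1#
    inflow-bound v = ≤.trans
      (≤.reflexive (sym (trans (∑-distrib-+ (indicator r (a v)) (λ u → X u v)) (+-congʳ (sum-indicator r (a v))))))
      (≤.trans (sum≤∑-over (λ u → ¬? (u ≟ v)) {f = λ u u≢v → x u v u≢v} on off) (X1 v))
      where
      on : ∀ u (u≢v : u ≢ v) → indicator r (a v) u + X u v ≤ x u v u≢v
      on u u≢v with u ≟ v | u ≟ r | v ≟ r
      ... | yes u≡v | _          | _     = contradiction u≡v u≢v
      ... | no _    | yes ≡.refl | no _  = ≤.reflexive (+-identityʳ _)
      ... | no _    | yes _      | yes _ = ≤.≤-respˡ-≈ (sym (+-identityʳ 0#)) (proj₁ (X3 u v u≢v))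
      ... | no _    | no _       | no _  = ≤.reflexive (+-identityˡ _)
      ... | no _    | no _       | yes _ = ≤.≤-respˡ-≈ (sym (+-identityʳ 0#)) (proj₁ (X3 u v u≢v))

      off : ∀ u → ¬ u ≢ v → indicator r (a v) u + X u v ≤ 0#
      off u ¬u≢v with u ≟ v | u ≟ r | v ≟ r
      ... | no u≢v     | _          | _       = contradiction u≢v ¬u≢v
      ... | yes _      | yes _      | yes _   = ≤.reflexive (+-identityʳ 0#)
      ... | yes ≡.refl | yes u≡r    | no v≢r  = contradiction u≡r v≢r
      ... | yes _      | no _       | _       = ≤.reflexive (+-identityʳ 0#)

    W≥0 : ∀ v i → 0# ≤ W v i
    W≥0 v i with v ≟ r
    ... | no _  = 0≤y-x (proj₂ (l-bounds v (suc i)))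
    ... | yes _ = 0≤1

    W≤1 : ∀ v i → W v i ≤ 1#
    W≤1 v i with v ≟ r
    ... | no _  = ≤-by (proj₁ (l-bounds v (suc i)))
                    (solve 2 (λ o b → b := o :- (o :- b)) refl 1# (l v (suc i)))
    ... | yes _ = ≤.refl

    W₀≈1 : ∀ v → W v zero ≈ 1#
    W₀≈1 v with v ≟ r
    ... | no v≢r = trans (+-congˡ (-‿cong (l-first v v≢r (suc zero) ≡.refl)))
                         (solve 0 (:1 :- :0 := :1) refl)
    ... | yes _  = refl

    -- For arcs off the root this is the constraint `arc` at index i + 1, with g eliminated by
    -- `g+l`. In the cases of weight 0, the bounds 0 ≤ W ≤ 1 suffice.
    W-along : ∀ u v i → W u (inject₁ i) + X u v ≤ W v (suc i) + 1#
    W-along u v i = bound (u ≟ v) (u ≟ r) (v ≟ r) (W≤1 u (inject₁ i)) (W≥0 v (suc i))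
      where
      trivial : ∀ {p q} → p ≤ 1# → 0# ≤ q → p + 0# ≤ q + 1#
      trivial {p} {q} p≤1 0≤q = ≤-by (+-nonneg (0≤y-x p≤1) 0≤q)
        (solve 2 (λ p q → (:1 :- p) :+ q := (q :+ :1) :- (p :+ :0)) refl p q)

      bound : (d₁ : Dec (u ≡ v)) (d₂ : Dec (u ≡ r)) (d₃ : Dec (v ≡ r)) →
              survival d₂ (inject₁ i) ≤ 1# → 0# ≤ survival d₃ (suc i) →
              survival d₂ (inject₁ i) + weight d₁ d₂ d₃ ≤ survival d₃ (suc i) + 1#
      bound (yes _)  _       _       = trivial
      bound (no _)   (yes _) _       = trivial
      bound (no _)   (no _)  (yes _) = trivial
      bound (no u≢v) (no _)  (no _)  _ _ = ≤-by (0≤y-x (arc u v u≢v (inject₁ (suc i))))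
        (trans (+-congʳ (+-congˡ g≈1-l))
          (solve 3 (λ a b x → (a :+ (:1 :- b)) :- x := ((:1 :- b) :+ :1) :- ((:1 :- a) :+ x)) refl
            (l u (suc (inject₁ i))) (l v (suc (suc i))) (x u v u≢v)))
        where
        g≈1-l : g (inject₁ (suc i)) v ≈ 1# - l v (suc (suc i))
        g≈1-l = trans (solve 2 (λ a b → a := (a :+ b) :- b) refl _ _) (+-congʳ (g+l v (suc i)))

    -- Y is abstract, since the with-abstractions below would normalise its construction.
    module _ {Y : V → Fin (suc m) → Carrier} (Y-positions : IsPositions X a W Y) where

      open IsPositions Y-positions

      Y-from-root : ∀ v (r≢v : r ≢ v) → x r v r≢v ≤ Y v zero
      Y-from-root v r≢v with v ≟ r | from-root v
      ... | no _    | a≤Y = a≤Y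
      ... | yes v≡r | _   = contradiction (≡.sym v≡r) r≢v

      Y-along : ∀ u v (u≢v : u ≢ v) → u ≢ r → v ≢ r → ∀ i →
                Y u (inject₁ i) + x u v u≢v ≤ Y v (suc i) + 1#
      Y-along u v u≢v u≢r v≢r i with u ≟ v | u ≟ r | v ≟ r | along u v i
      ... | no _    | no _    | no _    | bound = bound
      ... | no _    | no _    | yes v≡r | _     = contradiction v≡r v≢r
      ... | no _    | yes u≡r | _       | _     = contradiction u≡r u≢r
      ... | yes u≡v | _       | _       | _     = contradiction u≡v u≢v

      Y-capped : ∀ v → v ≢ r → ∀ i → Y v i ≤ 1# - l v (suc i)
      Y-capped v v≢r i with v ≟ r | capped v i
      ... | no _    | Y≤W = Y≤W
      ... | yes v≡r | _   = contradiction v≡r v≢r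

      Y≤1 : ∀ v i → Y v i ≤ 1#
      Y≤1 v i = ≤.trans (capped v i) (W≤1 v i)

      -- At index 0, x is at most l u 0 + g 0 r = l u 0, and l u 0 ≤ l u 1 = 0 by monotonicity.
      into-root : ∀ u (u≢r : u ≢ r) → x u r u≢r ≤ 0#
      into-root u u≢r = ≤-by
        (+-nonneg (0≤y-x (arc u r u≢r zero)) (0≤y-x (l-mono u zero)))
        (trans (+-cong (+-congʳ (+-congˡ g-root)) (+-congˡ (-‿cong (+-congˡ (-‿cong (l-first u u≢r (suc zero) ≡.refl))))))
          (solve 2 (λ a x → ((a :+ :0) :- x) :+ (:0 :- (a :- :0)) := :0 :- x) refl (l u zero) (x u r u≢r)))

      place : ∀ {v} → Dec (v ≡ r) → Index → Carrier
      place     (yes _) zero    = 1#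
      place     (yes _) (suc _) = 0#
      place     (no _)  zero    = 0#
      place {v} (no _)  (suc i) = Y v i

      y : V → Index → Carrier
      y v = place (v ≟ r)

      y∈𝒜 : 𝒜 x y
      y∈𝒜 = record
        { common     = common
        ; root-zero  = root-zero′
        ; root-suc   = root-suc′
        ; other-zero = other-zero′
        ; other-sum  = other-sum′
        ; arc        = λ u v u≢v → arc′ (u ≟ r) (v ≟ r) u≢v
        ; arc-last   = λ u v u≢v → arc-last′ (u ≟ r) (v ≟ r) u≢v
        ; y-bounds   = λ v → bounds (v ≟ r)
        }
        where
        root-zero′ : y r zero ≈ 1#
        root-zero′ with r ≟ r
        ... | yes _  = refl
        ... | no r≢r = contradiction ≡.refl r≢r

        root-suc′ : ∀ i → y r (suc i) ≈ 0#
        root-suc′ i with r ≟ r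
        ... | yes _  = refl
        ... | no r≢r = contradiction ≡.refl r≢r

        other-zero′ : ∀ v → v ≢ r → y v zero ≈ 0#
        other-zero′ v v≢r with v ≟ r
        ... | yes v≡r = contradiction v≡r v≢r
        ... | no _    = refl

        other-sum′ : ∀ v → v ≢ r → sum (λ i → y v (suc i)) ≈ 1#
        other-sum′ v v≢r with v ≟ r
        ... | yes v≡r = contradiction v≡r v≢r
        ... | no _    = total v

        bounds : ∀ {v} (d : Dec (v ≡ r)) i → InUnitInterval (place d i)
        bounds (yes _) zero    = 0≤1 , ≤.refl
        bounds (yes _) (suc i) = ≤.refl , 0≤1
        bounds (no _)  zero    = ≤.refl , 0≤1
        bounds (no _)  (suc i) = nonneg _ i , Y≤1 _ i

        arc-zero : ∀ {q z} → 0# ≤ q → z ≤ 1# → (0# - q) + z ≤ 1#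
        arc-zero {q} {z} 0≤q z≤1 = ≤-by (+-nonneg 0≤q (0≤y-x z≤1))
          (solve 3 (λ q z o → q :+ (o :- z) := o :- ((:0 :- q) :+ z)) refl q z 1#)

        -- An arc out of the root matters at index 0, where `Y-from-root` applies; arcs between
        -- other nodes use `Y-along`, and arcs into the root use `into-root`. Where the tail has no
        -- mass, x ≤ 1 suffices.
        arc′ : ∀ {u v} (d : Dec (u ≡ r)) (e : Dec (v ≡ r)) (u≢v : u ≢ v) (i : Fin (suc m)) →
               (place d (inject₁ i) - place e (suc i)) + x u v u≢v ≤ 1#
        arc′ (yes u≡r) (yes v≡r) u≢v _ = contradiction (≡.trans u≡r (≡.sym v≡r)) u≢v
        arc′ {v = v} (yes ≡.refl) (no _) u≢v zero = ≤-by (0≤y-x (Y-from-root v u≢v))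
          (solve 3 (λ q z o → q :- z := o :- ((o :- q) :+ z)) refl (Y v zero) (x r v u≢v) 1#)
        arc′ {v = v} (yes _) (no _) u≢v (suc i) = arc-zero (nonneg v (suc i)) (proj₂ (X3 _ _ u≢v))
        arc′ {v = v} (no _) (no _) u≢v zero = arc-zero (nonneg v zero) (proj₂ (X3 _ _ u≢v))
        arc′ {u} {v} (no u≢r) (no v≢r) u≢v (suc i) = ≤-by (0≤y-x (Y-along u v u≢v u≢r v≢r i))
          (solve 4 (λ p q z o → (q :+ o) :- (p :+ z) := o :- ((p :- q) :+ z)) refl
            (Y u (inject₁ i)) (Y v (suc i)) (x u v u≢v) 1#)
        arc′ (no _) (yes _) u≢v zero = arc-zero ≤.refl (proj₂ (X3 _ _ u≢v))
        arc′ {u} (no _) (yes ≡.refl) u≢v (suc i) = ≤-by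
          (+-nonneg (0≤y-x (Y≤1 u (inject₁ i))) (0≤y-x (into-root u u≢v)))
          (solve 3 (λ p z o → (o :- p) :+ (:0 :- z) := o :- ((p :- :0) :+ z)) refl (Y u (inject₁ i)) (x u r u≢v) 1#)

        -- For arcs off the root, g vanishes at index H, so x is at most l u H, while the cap keeps
        -- Y below 1 - l u H.
        arc-last′ : ∀ {u v} (d : Dec (u ≡ r)) (e : Dec (v ≡ r)) (u≢v : u ≢ v) →
                    place d (fromℕ (suc m)) + x u v u≢v ≤ 1#
        -- As H ≥ 1, the root has mass 0 at index H.
        arc-last′ (yes _) _ u≢v = ≤.≤-respˡ-≈ (sym (+-identityˡ _)) (proj₂ (X3 _ _ u≢v))
        arc-last′ {u} (no _) (yes ≡.refl) u≢v = ≤.≤-respʳ-≈ (+-identityʳ 1#)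
          (+-mono-≤ (Y≤1 u (fromℕ m)) (into-root u u≢v))
        arc-last′ {u} {v} (no u≢r) (no v≢r) u≢v = ≤-by
          (+-nonneg (0≤y-x (Y-capped u u≢r (fromℕ m))) (0≤y-x (arc u v u≢v (fromℕ (suc m)))))
          (trans (+-congˡ (+-congʳ (+-congˡ (g-last v v≢r))))
            (solve 4 (λ p L z o → ((o :- L) :- p) :+ ((L :+ :0) :- z) := o :- (p :+ z)) refl
              (Y u (fromℕ m)) (l u (fromℕ (suc m))) (x u v u≢v) 1#))

    x∈𝒜X : 𝒜X x
    x∈𝒜X = let Y , Y-positions = positions X a W X≥0 a≥0 inflow-bound W≥0 W₀≈1 W-along in y Y-positions , y∈𝒜 Y-positions

open import Data.Nat.Base using (_≤_)

theorem2 : ∀ {c ℓ₁ ℓ₂} (F : OrderedField c ℓ₁ ℓ₂) (n : ℕ) (r : Fin n) (H : ℕ) → 1 ≤ H →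
    Polytopes.𝒫X F n r H ⊆ Polytopes.𝒜X F n r H
theorem2 F n r (suc m) _ (l , g , p) = Inclusion.x∈𝒜X F r m p
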